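{- Let $G$ be a planar graph and $R\subseteq V(G)$ a set of terminals. (1) If $|R|=3$, then every $R$-CIST of $G$ has size at most $5$. (2) If $|R|\ge 4$, then every $R$-CIST of $G$ has size at most $4$.
   Context: Graphs are finite and connected, may have parallel edges but no loops. For a tree $T$, $\mathrm{int}(T)$ is the set of vertices of degree at least 2 in $T$ and $L(T)$ the set of leaves. An $R$-Steiner tree is a subtree $T$ of $G$ with $R\subseteq V(T)$ and $L(T)\subseteq R$; $T(u,v)$ is the unique $(u,v)$-path in $T$. An $R$-CIST of size $k$ is a set $\{T_1,\dots,T_k\}$ of $R$-Steiner trees such that for all distinct $u,v\in R$ and distinct $i,j$, $T_i(u,v)$ and $T_j(u,v)$ are edge-disjoint and internally vertex-disjoint. -}

module Defs where

open import Data.Nat using (ℕ; zero; suc; _+_; _*_; _≤ᵇ_)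
open import Data.Bool using (Bool; true; false; not; if_then_else_; _∨_; _∧_)
open import Data.Fin using (Fin; toℕ)
open import Data.Fin.Properties using (_≟_)
open import Data.Fin.Subset using (Subset; _∈_; _∩_; _⊆_; ∣_∣)
open import Data.Vec using (tabulate)
open import Data.List using (List; []; _∷_; map; concatMap; allFin; upTo)
open import Data.Bool.ListAction using (and)
open import Data.Nat.ListAction using (sum)
open import Data.List.Relation.Unary.All using (All)
open import Data.List.Relation.Unary.Unique.Propositional using (Unique)
import Data.List.Membership.Propositional as L
open import Data.Product using (Σ; ∃; _×_; _,_; proj₁; proj₂)
open import Data.Sum using (_⊎_)
open import Data.Empty using (⊥)
open import Relation.Nullary using (¬_)
open import Relation.Nullary.Decidable using (⌊_⌋)
open import Relation.Binary.PropositionalEquality using (_≡_; _≢_)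

record Graph : Set where
  field
    nV : ℕ
    nE : ℕ
    ends : Fin nE → Fin nV × Fin nV
    loopless : ∀ e → proj₁ (ends e) ≢ proj₂ (ends e)

module _ (G : Graph) where
  open Graph G

  Joins : Fin nE → Fin nV → Fin nV → Set
  Joins e x y = (ends e ≡ (x , y)) ⊎ (ends e ≡ (y , x))

  data Walk : Fin nV → Fin nV → Set where
    []   : ∀ {v} → Walk v v
    step : ∀ {u w v} (e : Fin nE) → Joins e u w → Walk w v → Walk u v

  walkEdges : ∀ {u v} → Walk u v → List (Fin nE)
  walkEdges []           = []
  walkEdges (step e _ P) = e ∷ walkEdges P

  walkVerts : ∀ {u v} → Walk u v → List (Fin nV)
  walkVerts {u} []           = u ∷ []
  walkVerts {u} (step _ _ P) = u ∷ walkVerts P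

  IsPath : ∀ {u v} → Walk u v → Set
  IsPath P = Unique (walkVerts P)

  UsesOnly : ∀ {u v} → Subset nE → Walk u v → Set
  UsesOnly ET P = All (λ e → e ∈ ET) (walkEdges P)

  Connected : Set
  Connected = ∀ u v → Walk u v

  HasCycleIn : Subset nE → Set
  HasCycleIn ET =
    Σ (Fin nV) λ v → Σ (Fin nV) λ w → Σ (Fin nE) λ e → Σ (Joins e v w) λ j →
    Σ (Walk w v) λ P →
      Unique (walkEdges (step e j P)) × Unique (walkVerts P) × UsesOnly ET (step e j P)

  record IsTree (VT : Subset nV) (ET : Subset nE) : Set where
    field
      endsIn    : ∀ e → e ∈ ET → (proj₁ (ends e) ∈ VT) × (proj₂ (ends e) ∈ VT)
      nonempty  : ∃ λ v → v ∈ VT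
      connected : ∀ u v → u ∈ VT → v ∈ VT → Σ (Walk u v) (UsesOnly ET)
      acyclic   : ¬ HasCycleIn ET

  incident : Fin nV → Subset nE
  incident v = tabulate λ e → ⌊ proj₁ (ends e) ≟ v ⌋ ∨ ⌊ proj₂ (ends e) ≟ v ⌋

  deg : Subset nE → Fin nV → ℕ
  deg ET v = ∣ ET ∩ incident v ∣

  IsSteinerTree : Subset nV → Subset nV → Subset nE → Set
  IsSteinerTree R VT ET =
    IsTree VT ET × (R ⊆ VT) × (∀ v → v ∈ VT → deg ET v ≡ 1 → v ∈ R)

  STree : Set
  STree = Subset nV × Subset nE

  IsCIST : Subset nV → (k : ℕ) → (Fin k → STree) → Set
  IsCIST R k T =
    (∀ i → IsSteinerTree R (proj₁ (T i)) (proj₂ (T i))) ×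
    (∀ i j → i ≢ j → ∀ u v → u ∈ R → v ∈ R → u ≢ v →
      (P : Walk u v) → IsPath P → UsesOnly (proj₂ (T i)) P →
      (Q : Walk u v) → IsPath Q → UsesOnly (proj₂ (T j)) Q →
      (∀ e → e L.∈ walkEdges P → e L.∈ walkEdges Q → ⊥) ×
      (∀ x → x L.∈ walkVerts P → x L.∈ walkVerts Q → (x ≡ u) ⊎ (x ≡ v)))

  -- Planarity, via combinatorial embeddings (rotation systems).
  -- Darts: (e , true) leaves proj₁ (ends e), (e , false) leaves proj₂ (ends e).
  Dart : Set
  Dart = Fin nE × Bool

  tail : Dart → Fin nV
  tail (e , true)  = proj₁ (ends e)
  tail (e , false) = proj₂ (ends e)

  reverse : Dart → Dart
  reverse (e , b) = (e , not b)

  code : Dart → ℕ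
  code (e , b) = 2 * toℕ e + (if b then 1 else 0)

  iter : (Dart → Dart) → ℕ → Dart → Dart
  iter f zero    d = d
  iter f (suc k) d = f (iter f k d)

  allDarts : List Dart
  allDarts = concatMap (λ e → (e , true) ∷ (e , false) ∷ []) (allFin nE)

  record RotationSystem : Set where
    field
      σ     : Dart → Dart
      σ⁻¹   : Dart → Dart
      invˡ  : ∀ d → σ (σ⁻¹ d) ≡ d
      invʳ  : ∀ d → σ⁻¹ (σ d) ≡ d
      local : ∀ d → tail (σ d) ≡ tail d
      cyclic : ∀ d d′ → tail d ≡ tail d′ → ∃ λ k → iter σ k d ≡ d′

  -- number of faces = number of orbits of φ = σ ∘ reverse
  -- (counted as the darts that are code-minimal in their φ-orbit;
  --  orbits have length ≤ 2·nE)
  faceCount : RotationSystem → ℕ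
  faceCount ρ = sum (map (λ d → if isMin d then 1 else 0) allDarts)
    where
      open RotationSystem ρ
      φ : Dart → Dart
      φ d = σ (reverse d)
      isMin : Dart → Bool
      isMin d = and (map (λ k → code d ≤ᵇ code (iter φ k d)) (upTo (2 * nE)))

  -- G (connected) is planar iff it is a single vertex or it has a
  -- rotation system of genus 0, i.e. V − E + F = 2.
  Planar : Set
  Planar = (nV ≡ 1) ⊎ Σ RotationSystem (λ ρ → nV + faceCount ρ ≡ nE + 2)

-- Over 𝔽₂, Euler's formula makes cycles bound: walks to a root and face colourings together
-- inject into the edge sets, and the dimensions agree, so every edge set of even degree is the
-- boundary of a two-colouring of the faces.  Such a colouring is constant along any path that
-- misses the cycle.  Hence three internally disjoint u-v paths have opposite cyclic orders at u
-- and v, so three trees having three terminals as leaves are impossible (three signs would be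
-- pairwise different); and two cycles meeting in one vertex do not cross there.
--
-- Each terminal is internal in at most one tree.  With six trees and three terminals, three trees
-- remain with all terminals as leaves.  With five trees and four terminals, avoiding this forces
-- the terminals a, b, c, d to be internal in four different trees; then among the four trees where
-- a is a leaf, all three pairings extend to pairs of cycles meeting only in a, while in any cyclic
-- order of four darts one pairing crosses.

module Submission where

open import Defs
open import Algebra.Bundles using (CommutativeMonoid; CommutativeRing)
import Algebra.Properties.CommutativeSemigroup as CommutativeSemigroupProperties
import Algebra.Properties.Semiring.Sum as SemiringSum
open import Data.Bool using (Bool; true; false; not; _∧_; _xor_; if_then_else_; T)
open import Data.Bool.ListAction using (and)
open import Data.Bool.Properties
  using (T-≡; xor-∧-commutativeRing; xor-same; xor-comm; xor-identityʳ; ∧-comm; ∧-assoc; ∧-zeroʳ; ∧-identityʳ;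
         not-involutive; not-injective; not-¬; ¬-not; not-distribʳ-xor)
  renaming (_≟_ to _≟B_)
open import Data.Empty using (⊥; ⊥-elim; ⊥-elim-irr)
open import Data.Fin using (Fin; zero; suc; toℕ; fromℕ<; combine; remQuot; punchOut)
open import Data.Fin.Patterns using (0F; 1F; 2F; 3F)
open import Data.Fin.Properties
  using (any?; injective⇒≤; punchOut-injective; combine-remQuot; remQuot-combine; 2↔Bool;
         toℕ<n; toℕ-injective; pigeonhole; fromℕ<-injective; suc-injective)
  renaming (_≟_ to _≟F_)
open import Data.Fin.Subset using (Subset; inside; outside; ∣_∣) renaming (_∈_ to _∈S_)
open import Data.Fin.Subset.Properties using (∣p∣≤n)
open import Data.List using (List; []; _∷_; map; upTo; concatMap; allFin; length)
open import Data.List.Membership.Propositional using (_∈_; _∉_)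
open import Data.List.Membership.Propositional.Properties using (∈-upTo⁺)
import Data.List.Membership.DecPropositional as DecMembership
open import Data.List.Properties using (length-tabulate)
open import Data.List.Relation.Unary.All using (All; []; _∷_)
import Data.List.Relation.Unary.All as All
open import Data.List.Relation.Unary.All.Properties using (¬Any⇒All¬; All¬⇒¬Any)
open import Data.List.Relation.Unary.AllPairs using ([]; _∷_)
open import Data.List.Relation.Unary.Any using (here; there)
open import Data.List.Relation.Unary.Unique.Propositional using (Unique)
open import Data.List.Relation.Unary.Unique.Propositional.Properties using (allFin⁺)
open import Data.Nat using (ℕ; zero; suc; _+_; _*_; _∸_; _^_; _≤_; _<_; _≤ᵇ_; z≤n; s≤s)
open import Data.Nat.DivMod using (_%_; _/_; m≡m%n+[m/n]*n; m%n<n)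
open import Data.Nat.Induction using (Acc; acc; <-wellFounded)
open import Data.Nat.ListAction using () renaming (sum to sumℕ)
open import Data.Nat.Properties
  using (1+n≰n; n<1+n; ≤-refl; ≤-reflexive; ≤-trans; ≤-antisym; ≤-pred; ≰⇒>; ≮⇒≥; ≤ᵇ⇒≤; ≤⇒≤ᵇ;
         +-comm; +-suc; +-identityʳ; +-cancelʳ-≡; +-monoʳ-≤; *-suc; *-cancelˡ-≡; *-monoʳ-≤; even≢odd;
         m+[n∸m]≡n; m≤n+m)
open import Data.Product using (Σ; ∃; _×_; _,_; proj₁; proj₂)
open import Data.Product.Properties using (≡-dec)
open import Data.Sum using (_⊎_; inj₁; inj₂)
import Data.Sum as Sum
open import Data.Unit using (⊤; tt)
open import Data.Vec using (Vec; []; _∷_; _++_; take; drop; lookup; tabulate)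
import Data.Vec as Vec
open import Data.Vec.Properties
  using (take++drop≡id; ++-injective; lookup∘tabulate; tabulate-cong; tabulate∘lookup)
open import Function using (_∘_; id; Equivalence; Inverse)
open import Function.Definitions using (Injective)
open import Relation.Binary.PropositionalEquality hiding ([_])
open import Relation.Nullary using (¬_; Dec; yes; no)
open import Relation.Nullary.Decidable using (does; dec-true; dec-false; ¬?; _×-dec_)
open import Relation.Unary using (Decidable)

-- Boolean vectors

-- Behind the exclusion of three trees stands a subdivided K₃,₃: three terminals on one side and, on
-- the other, the median of these terminals in each tree. No minors or medians are constructed,
-- however. A face is known only as an orbit of darts, so the sides of a cycle are Boolean values of
-- darts, and topological statements become statements about how such a value changes while `σ`
-- turns around one vertex: it flips after the two cycle darts and nowhere else. Euler's formula
-- enters only through `jordan`. The obstacle on the side of the trees is that the definition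
-- compares two trees only along paths with the same two ends. Paths to different terminals are
-- controlled by rerouting them through a third one (`fan-meet`). This yields both that a terminal
-- is internal in at most one tree and that the cycles paired at `a` meet nowhere else.

Fin-injective⇒surjective : ∀ {n} (f : Fin n → Fin n) → Injective _≡_ _≡_ f →
  ∀ y → ∃ λ x → f x ≡ y
Fin-injective⇒surjective {suc n} f inj y with any? (λ x → f x ≟F y)
... | yes p = p
-- Punching the missed value out of the codomain would inject `Fin (suc n)` into `Fin n`.
... | no ∄x = ⊥-elim (1+n≰n (injective⇒≤ {f = λ x → punchOut (y≢f x)}
                        (inj ∘ punchOut-injective (y≢f _) (y≢f _))))
  where
  y≢f : ∀ x → y ≢ f x
  y≢f x y≡fx = ∄x (x , sym y≡fx)

encode : ∀ {n} → Vec Bool n → Fin (2 ^ n)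
encode []      = zero
encode (b ∷ v) = combine (Inverse.from 2↔Bool b) (encode v)

mutual
  decode : ∀ {n} → Fin (2 ^ n) → Vec Bool n
  decode {zero}  _ = []
  decode {suc n} i = decodePair (remQuot {2} (2 ^ n) i)

  decodePair : ∀ {n} → Fin 2 × Fin (2 ^ n) → Vec Bool (suc n)
  decodePair (b , j) = Inverse.to 2↔Bool b ∷ decode j

decode-encode : ∀ {n} (v : Vec Bool n) → decode (encode v) ≡ v
decode-encode []      = refl
decode-encode {suc n} (b ∷ v) = trans
  (cong decodePair (remQuot-combine {2} {2 ^ n} (Inverse.from 2↔Bool b) (encode v)))
  (cong₂ _∷_ (Inverse.strictlyInverseˡ 2↔Bool b) (decode-encode v))

encode-decode : ∀ {n} (i : Fin (2 ^ n)) → encode {n} (decode i) ≡ i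
encode-decode {zero}  zero = refl
encode-decode {suc n} i = trans
  (cong₂ combine (Inverse.strictlyInverseʳ 2↔Bool (proj₁ (remQuot {2} (2 ^ n) i)))
                 (encode-decode {n} (proj₂ (remQuot {2} (2 ^ n) i))))
  (combine-remQuot {2} (2 ^ n) i)

-- This stands in for a comparison of dimensions: Euler's formula becomes the equality of two
-- exponents of 2, and no bases or ranks are needed.
Vec-injective⇒surjective : ∀ {m n} → m ≡ n → (f : Vec Bool m → Vec Bool n) → Injective _≡_ _≡_ f →
  ∀ y → ∃ λ x → f x ≡ y
Vec-injective⇒surjective {m} refl f inj y =
  let (i , eq) = Fin-injective⇒surjective (encode ∘ f ∘ decode {m}) inj′ (encode y)
  in decode i , encode-injective eq
  where
  encode-injective : Injective _≡_ _≡_ (encode {m})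
  encode-injective {v} {w} eq = trans (sym (decode-encode v)) (trans (cong decode eq) (decode-encode w))
  inj′ : Injective _≡_ _≡_ (encode ∘ f ∘ decode {m})
  inj′ {i} {j} eq = trans (sym (encode-decode {m} i))
    (trans (cong encode (inj (encode-injective eq))) (encode-decode {m} j))

module _ {A : Set} (p : A → Bool) where

  and-map-true : ∀ xs → and (map p xs) ≡ true → ∀ {x} → x ∈ xs → p x ≡ true
  and-map-true (x ∷ xs) eq x∈ with p x in px
  and-map-true (x ∷ xs) eq (here refl) | true = px
  and-map-true (x ∷ xs) eq (there x∈)  | true = and-map-true xs eq x∈

  and-map-false : ∀ xs → and (map p xs) ≡ false → ∃ λ x → x ∈ xs × p x ≡ false
  and-map-false (x ∷ xs) eq with p x in px
  ... | false = x , here refl , px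
  ... | true  = let (y , y∈ , py) = and-map-false xs eq in y , there y∈ , py

module _ {A : Set} (_≟_ : (x y : A) → Dec (x ≡ y)) (p : A → Bool) where

  -- Shaped exactly like `faceCount`, with which it has to agree definitionally: a bit vector of
  -- that length is then one bit per code-minimal dart, that is, per face.
  count : List A → ℕ
  count xs = sumℕ (map (λ a → if p a then 1 else 0) xs)

  spread : ∀ xs → Vec Bool (count xs) → A → Bool
  spread []       v a = false
  spread (x ∷ xs) v a with p x
  spread (x ∷ xs) v a       | false = spread xs v a
  spread (x ∷ xs) (b ∷ v) a | true  = if does (a ≟ x) then b else spread xs v a

  -- Without repetitions no entry shadows a later one, so every bit can be read off at its own
  -- element.
  spread-injective : ∀ xs → Unique xs → (v w : Vec Bool (count xs)) →
    (∀ a → a ∈ xs → p a ≡ true → spread xs v a ≡ spread xs w a) → v ≡ w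
  spread-injective []       _ [] [] _ = refl
  spread-injective (x ∷ xs) (x∉ ∷ u) v w eq with p x in px
  ... | false = spread-injective xs u v w λ a a∈ → eq a (there a∈)
  spread-injective (x ∷ xs) (x∉ ∷ u) (b ∷ v) (c ∷ w) eq | true =
    cong₂ _∷_ b≡c (spread-injective xs u v w tail-eq)
    where
    b≡c : b ≡ c
    b≡c with eq x (here refl) px
    ... | e rewrite dec-true (x ≟ x) refl = e
    tail-eq : ∀ a → a ∈ xs → p a ≡ true → spread xs v a ≡ spread xs w a
    tail-eq a a∈ pa with eq a (there a∈) pa
    ... | e rewrite dec-false (a ≟ x) (All.lookup x∉ a∈ ∘ sym) = e

-- Orbits and their code-minimal darts

module _ (G : Graph) where
  open Graph G

  _≟D_ : (d d′ : Dart G) → Dec (d ≡ d′)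
  _≟D_ = ≡-dec _≟F_ _≟B_

  reverse-involutive : ∀ d → reverse G (reverse G d) ≡ d
  reverse-involutive (e , b) = cong (e ,_) (not-involutive b)

  code-injective : ∀ {d d′} → code G d ≡ code G d′ → d ≡ d′
  code-injective {e , true}  {e′ , true}  eq =
    cong (_, true) (toℕ-injective (*-cancelˡ-≡ _ _ 2 (+-cancelʳ-≡ 1 _ _ eq)))
  code-injective {e , false} {e′ , false} eq =
    cong (_, false) (toℕ-injective (*-cancelˡ-≡ _ _ 2 (+-cancelʳ-≡ 0 _ _ eq)))
  code-injective {e , true}  {e′ , false} eq =
    ⊥-elim (even≢odd (toℕ e′) (toℕ e) (sym (trans (+-comm 1 _) (trans eq (+-identityʳ _)))))
  code-injective {e , false} {e′ , true}  eq =
    ⊥-elim (even≢odd (toℕ e) (toℕ e′) (trans (sym (+-identityʳ _)) (trans eq (+-comm _ 1))))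

  code-bound : ∀ d → code G d < 2 * nE
  code-bound (e , b) = ≤-trans (s≤s (+-monoʳ-≤ (2 * toℕ e) (bit≤1 b)))
    (≤-trans (≤-reflexive eq) (*-monoʳ-≤ 2 (toℕ<n e)))
    where
    bit≤1 : ∀ b → (if b then 1 else 0) ≤ 1
    bit≤1 true  = ≤-refl
    bit≤1 false = z≤n
    eq : suc (2 * toℕ e + 1) ≡ 2 * suc (toℕ e)
    eq = trans (cong suc (+-comm _ 1)) (sym (*-suc 2 (toℕ e)))

  private
    both : Fin nE → List (Dart G)
    both e = (e , true) ∷ (e , false) ∷ []

  ∈-concatMap-both⁻ : ∀ es {d} → d ∈ concatMap both es → proj₁ d ∈ es
  ∈-concatMap-both⁻ (e ∷ es) (here refl)         = here refl
  ∈-concatMap-both⁻ (e ∷ es) (there (here refl)) = here refl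
  ∈-concatMap-both⁻ (e ∷ es) (there (there d∈))  = there (∈-concatMap-both⁻ es d∈)

  concatMap-both-unique : ∀ {es} → Unique es → Unique (concatMap both es)
  concatMap-both-unique []       = []
  concatMap-both-unique {e ∷ es} (e∉ ∷ u) =
    ((λ ()) ∷ fresh) ∷ fresh ∷ concatMap-both-unique u
    where
    fresh : ∀ {b} → All ((e , b) ≢_) (concatMap both es)
    fresh = ¬Any⇒All¬ _ λ d∈ → All.lookup e∉ (∈-concatMap-both⁻ es d∈) refl

  allDarts-unique : Unique (allDarts G)
  allDarts-unique = concatMap-both-unique (allFin⁺ nE)

  module Orbits (f : Dart G → Dart G) (f-injective : ∀ {d d′} → f d ≡ f d′ → d ≡ d′) where

    iter-+ : ∀ m n d → iter G f (m + n) d ≡ iter G f m (iter G f n d)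
    iter-+ zero    n d = refl
    iter-+ (suc m) n d = cong f (iter-+ m n d)

    iter-injective : ∀ m {d d′} → iter G f m d ≡ iter G f m d′ → d ≡ d′
    iter-injective zero    eq = eq
    iter-injective (suc m) eq = iter-injective m (f-injective eq)

    -- Two of the first `2 * nE + 1` iterates have equal codes, and injectivity cancels their common
    -- prefix. The bound is the window that `isMin` inspects, so this window covers a whole orbit.
    period : ∀ d → ∃ λ p → suc p ≤ 2 * nE × iter G f (suc p) d ≡ d
    period d with pigeonhole (n<1+n (2 * nE)) (λ i → fromℕ< (code-bound (iter G f (toℕ i) d)))
    ... | i , j , i<j , eq = p , suc-p≤ , iter-injective (toℕ i) (begin
        iter G f (toℕ i) (iter G f (suc p) d)  ≡⟨ iter-+ (toℕ i) (suc p) d ⟨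
        iter G f (toℕ i + suc p) d             ≡⟨ cong (λ k → iter G f k d) i+p≡j ⟩
        iter G f (toℕ j) d                     ≡⟨ code-injective (fromℕ<-injective _ _ _ _ eq) ⟨
        iter G f (toℕ i) d                     ∎)
      where
      open ≡-Reasoning
      -- One less than the period, which as `suc p` is visibly a nonzero divisor for `%`.
      p = toℕ j ∸ suc (toℕ i)
      i+p≡j : toℕ i + suc p ≡ toℕ j
      i+p≡j = trans (+-suc (toℕ i) p) (m+[n∸m]≡n i<j)
      suc-p≤ : suc p ≤ 2 * nE
      suc-p≤ = ≤-trans (≤-trans (m≤n+m (suc p) (toℕ i)) (≤-reflexive i+p≡j)) (≤-pred (toℕ<n j))

    Reach : Dart G → Dart G → Set
    Reach d d′ = ∃ λ k → iter G f k d ≡ d′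

    Reach-trans : ∀ {d d′ d″} → Reach d d′ → Reach d′ d″ → Reach d d″
    Reach-trans (k , refl) (l , refl) = l + k , iter-+ l k _

    iter-return : ∀ p {d} → iter G f (suc p) d ≡ d → iter G f p (f d) ≡ d
    iter-return p {d} eq = trans (sym (iter-+ p 1 d)) (trans (cong (λ m → iter G f m d) (+-comm p 1)) eq)

    -- A single step is undone by going round the rest of the cycle; `k` steps are undone one at a
    -- time.
    Reach-sym : ∀ {d d′} → Reach d d′ → Reach d′ d
    Reach-sym     (zero  , refl) = 0 , refl
    Reach-sym {d} (suc k , refl) =
      let (p , _ , eq) = period (iter G f k d)
      in Reach-trans (p , iter-return p eq) (Reach-sym (k , refl))

    iter-* : ∀ p q {d} → iter G f p d ≡ d → iter G f (q * p) d ≡ d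
    iter-* p zero    eq = refl
    iter-* p (suc q) eq = trans (iter-+ p (q * p) _) (trans (cong (iter G f p) (iter-* p q eq)) eq)

    iter-% : ∀ p k {d} → iter G f (suc p) d ≡ d → iter G f (k % suc p) d ≡ iter G f k d
    iter-% p k {d} eq = begin
      iter G f (k % suc p) d                                 ≡⟨ cong (iter G f (k % suc p)) (iter-* (suc p) (k / suc p) eq) ⟨
      iter G f (k % suc p) (iter G f (k / suc p * suc p) d)  ≡⟨ iter-+ (k % suc p) _ d ⟨
      iter G f (k % suc p + k / suc p * suc p) d             ≡⟨ cong (λ m → iter G f m d) (m≡m%n+[m/n]*n k (suc p)) ⟨
      iter G f k d                                           ∎
      where open ≡-Reasoning

    Reach-bounded : ∀ {d d′} → Reach d d′ → ∃ λ k → k < 2 * nE × iter G f k d ≡ d′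
    Reach-bounded {d} (k , refl) =
      let (p , p≤ , eq) = period d
      in k % suc p , ≤-trans (m%n<n k (suc p)) p≤ , iter-% p k eq

    below : Dart G → ℕ → Bool
    below d k = code G d ≤ᵇ code G (iter G f k d)

    isMin : Dart G → Bool
    isMin d = and (map (below d) (upTo (2 * nE)))

    isMin-≤ : ∀ {d d′} → isMin d ≡ true → Reach d d′ → code G d ≤ code G d′
    isMin-≤ {d} min r with Reach-bounded r
    ... | k , k< , refl = ≤ᵇ⇒≤ _ _ (Equivalence.from T-≡
      (and-map-true (below d) (upTo (2 * nE)) min (∈-upTo⁺ k<)))

    isMin-unique : ∀ {d d′} → isMin d ≡ true → isMin d′ ≡ true → Reach d d′ → d ≡ d′
    isMin-unique min min′ r = code-injective (≤-antisym (isMin-≤ min r) (isMin-≤ min′ (Reach-sym r)))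

    private
      -- A dart failing `isMin` has an iterate of smaller code, so the search descends.
      search : ∀ d → Acc _<_ (code G d) → ∃ λ m → Reach d m × isMin m ≡ true
      search d (acc rs) with isMin d in eq
      ... | true  = d , (0 , refl) , eq
      ... | false =
        let (k , _ , k-less) = and-map-false (below d) (upTo (2 * nE)) eq
            less = ≰⇒> λ le → case-false k-less (≤⇒≤ᵇ le)
            (m , r , min) = search (iter G f k d) (rs less)
        in m , Reach-trans (k , refl) r , min
        where
        case-false : ∀ {b} → b ≡ false → ¬ T b
        case-false refl ()

    minRep : Dart G → Dart G
    minRep d = proj₁ (search d (<-wellFounded _))

    Reach-minRep : ∀ d → Reach d (minRep d)
    Reach-minRep d = proj₁ (proj₂ (search d (<-wellFounded _)))

    isMin-minRep : ∀ d → isMin (minRep d) ≡ true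
    isMin-minRep d = proj₂ (proj₂ (search d (<-wellFounded _)))

    minRep-Reach : ∀ {d d′} → Reach d d′ → minRep d ≡ minRep d′
    minRep-Reach {d} {d′} r = isMin-unique (isMin-minRep d) (isMin-minRep d′)
      (Reach-trans (Reach-sym (Reach-minRep d)) (Reach-trans r (Reach-minRep d′)))

    minRep-isMin : ∀ {d} → isMin d ≡ true → minRep d ≡ d
    minRep-isMin {d} min = sym (isMin-unique min (isMin-minRep d) (Reach-minRep d))

-- Faces and the mod 2 cycle space

open CommutativeSemigroupProperties
  (CommutativeMonoid.commutativeSemigroup (CommutativeRing.+-commutativeMonoid xor-∧-commutativeRing))
  using (interchange)
open SemiringSum (CommutativeRing.semiring xor-∧-commutativeRing)
  using (sum; sum-cong-≗; ∑-distrib-+; ∑-comm; *-distribˡ-sum; *-distribʳ-sum; sum-replicate-zero)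

xor-interchange : ∀ a b c d → (a xor b) xor (c xor d) ≡ (a xor c) xor (b xor d)
xor-interchange = interchange

lookup-injective : ∀ {n} {v w : Vec Bool n} → (∀ i → lookup v i ≡ lookup w i) → v ≡ w
lookup-injective {v = v} {w} eq = trans (sym (tabulate∘lookup v)) (trans (tabulate-cong eq) (tabulate∘lookup w))

tabulate-injective : ∀ {n} {f g : Fin n → Bool} → tabulate f ≡ tabulate g → ∀ i → f i ≡ g i
tabulate-injective {f = f} {g} eq i =
  trans (sym (lookup∘tabulate f i)) (trans (cong (λ v → lookup v i) eq) (lookup∘tabulate g i))

xor-cancel : ∀ a b → a xor (a xor b) ≡ b
xor-cancel false b     = refl
xor-cancel true  false = refl
xor-cancel true  true  = refl

xor≡false⇒≡ : ∀ {a b} → a xor b ≡ false → a ≡ b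
xor≡false⇒≡ {false} {false} _ = refl
xor≡false⇒≡ {true}  {true}  _ = refl

not-xor : ∀ b → not b xor b ≡ true
not-xor false = refl
not-xor true  = refl

xor-not : ∀ b → b xor not b ≡ true
xor-not false = refl
xor-not true  = refl

not-xor-not : ∀ a b → not a xor not b ≡ a xor b
not-xor-not false b = not-involutive b
not-xor-not true  b = refl

xor-rearrange : ∀ a b c d → a xor b ≡ c xor d → b xor d ≡ a xor c
xor-rearrange false b false d eq = trans (cong (_xor d) eq) (xor-same d)
xor-rearrange false b true  d eq = trans (cong (_xor d) eq) (not-xor d)
xor-rearrange true  b false d eq = trans (cong (b xor_) (sym eq)) (xor-not b)
xor-rearrange true  b true  d eq = trans (cong (_xor d) (not-injective eq)) (xor-same d)

xor-swap : ∀ a b c d → a xor c ≡ b xor d → a xor b ≡ c xor d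
xor-swap a b c d eq = sym (xor-rearrange a c b d eq)

≢⇒xor : ∀ {a b} → a ≢ b → a xor b ≡ true
≢⇒xor {a} {b} a≢b = trans (cong (_xor b) (¬-not a≢b)) (not-xor b)

sum-zero : ∀ {n} {g : Fin n → Bool} → (∀ i → g i ≡ false) → sum g ≡ false
sum-zero {n} g≡0 = trans (sum-cong-≗ g≡0) (sum-replicate-zero n)

sum-δ : ∀ {n} (g : Fin n → Bool) i → sum (λ j → g j ∧ does (j ≟F i)) ≡ g i
sum-δ {suc n} g zero = begin
  (g zero ∧ true) xor sum (λ j → g (suc j) ∧ false)  ≡⟨ cong₂ _xor_ (∧-identityʳ (g zero)) (sum-zero (∧-zeroʳ ∘ g ∘ suc)) ⟩
  g zero xor false                                   ≡⟨ xor-identityʳ (g zero) ⟩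
  g zero                                             ∎
  where open ≡-Reasoning
sum-δ {suc n} g (suc i) = cong₂ _xor_ (∧-zeroʳ (g zero)) (sum-δ (g ∘ suc) i)

does-⇔ : ∀ {A B : Set} (a? : Dec A) (b? : Dec B) → (A → B) → (B → A) → does a? ≡ does b?
does-⇔ (yes a) b? f g = sym (dec-true b? (f a))
does-⇔ (no ¬a) b? f g = sym (dec-false b? (¬a ∘ g))

module _ (G : Graph) where
  open Graph G

  -- The dart of `e` that leaves `v`, meaningful only if `v` is an end of `e`.
  dartAt : Fin nE → Fin nV → Dart G
  dartAt e v = e , does (proj₁ (ends e) ≟F v)

  tail-dartAt : ∀ {e u w} → Joins G e u w → tail G (dartAt e u) ≡ u
  tail-dartAt {e} {u} {w} j with proj₁ (ends e) ≟F u
  ... | yes eq = eq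
  tail-dartAt (inj₁ refl) | no neq = ⊥-elim (neq refl)
  tail-dartAt (inj₂ refl) | no neq = refl

  reverse-dartAt : ∀ {e u w} → Joins G e u w → reverse G (dartAt e u) ≡ dartAt e w
  reverse-dartAt {e} {u} {w} (inj₁ refl) =
    trans (cong (λ b → e , not b) (dec-true (u ≟F u) refl)) (cong (e ,_) (sym (dec-false (u ≟F w) (loopless e))))
  reverse-dartAt {e} {u} {w} (inj₂ refl) =
    trans (cong (λ b → e , not b) (dec-false (w ≟F u) (loopless e))) (cong (e ,_) (sym (dec-true (w ≟F w) refl)))

  dartAt-tail : ∀ d → dartAt (proj₁ d) (tail G d) ≡ d
  dartAt-tail (e , true)  = cong (e ,_) (dec-true (proj₁ (ends e) ≟F _) refl)
  dartAt-tail (e , false) = cong (e ,_) (dec-false (proj₁ (ends e) ≟F _) (loopless e))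

  -- The walk as a chain over 𝔽₂: an edge traversed twice cancels, so arbitrary walks are as good as
  -- paths.
  parity : ∀ {u v} → Walk G u v → Fin nE → Bool
  parity []           g = false
  parity (step e _ P) g = does (g ≟F e) xor parity P g

  leaves : Dart G → Fin nV → Bool
  leaves d v = does (tail G d ≟F v)

  -- The boundary map mod 2. In a loopless graph it is the parity of the degree of `v` in `Z`.
  ∂ : (Fin nE → Bool) → Fin nV → Bool
  ∂ Z v = sum λ e → Z e ∧ (leaves (e , true) v xor leaves (e , false) v)

  ∂-cong : ∀ {Z Z′} → (∀ e → Z e ≡ Z′ e) → ∀ v → ∂ Z v ≡ ∂ Z′ v
  ∂-cong eq v = sum-cong-≗ λ e → cong (_∧ _) (eq e)

  ∂-xor : ∀ Z Z′ v → ∂ (λ e → Z e xor Z′ e) v ≡ ∂ Z v xor ∂ Z′ v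
  ∂-xor Z Z′ v = trans
    (sum-cong-≗ λ e → CommutativeRing.distribʳ xor-∧-commutativeRing _ (Z e) (Z′ e))
    (∑-distrib-+ (λ e → Z e ∧ _) (λ e → Z′ e ∧ _))

  ∂-sum : ∀ {n} (h : Fin n → Bool) (W : Fin n → Fin nE → Bool) v →
    ∂ (λ e → sum λ i → h i ∧ W i e) v ≡ sum (λ i → h i ∧ ∂ (W i) v)
  ∂-sum h W v = begin
    (sum λ e → sum (λ i → h i ∧ W i e) ∧ c e)    ≡⟨ sum-cong-≗ (λ e → *-distribʳ-sum (c e) (λ i → h i ∧ W i e)) ⟩
    (sum λ e → sum λ i → (h i ∧ W i e) ∧ c e)    ≡⟨ ∑-comm (λ e i → (h i ∧ W i e) ∧ c e) ⟩
    (sum λ i → sum λ e → (h i ∧ W i e) ∧ c e)    ≡⟨ sum-cong-≗ (λ i → sum-cong-≗ λ e → ∧-assoc (h i) (W i e) (c e)) ⟩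
    (sum λ i → sum λ e → h i ∧ (W i e ∧ c e))    ≡⟨ sum-cong-≗ (λ i → *-distribˡ-sum (h i) (λ e → W i e ∧ c e)) ⟨
    (sum λ i → h i ∧ ∂ (W i) v)                  ∎
    where
    open ≡-Reasoning
    c : Fin nE → Bool
    c e = leaves (e , true) v xor leaves (e , false) v

  ∂-edge : ∀ {e u w} → Joins G e u w → ∀ x → ∂ (λ g → does (g ≟F e)) x ≡ does (u ≟F x) xor does (w ≟F x)
  ∂-edge {e} {u} {w} j x = begin
    sum (λ g → does (g ≟F e) ∧ c g)       ≡⟨ sum-cong-≗ (λ g → ∧-comm _ (c g)) ⟩
    sum (λ g → c g ∧ does (g ≟F e))       ≡⟨ sum-δ c e ⟩
    c e                                   ≡⟨ ends-of j ⟩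
    does (u ≟F x) xor does (w ≟F x)       ∎
    where
    open ≡-Reasoning
    c : Fin nE → Bool
    c g = leaves (g , true) x xor leaves (g , false) x
    ends-of : Joins G e u w → c e ≡ does (u ≟F x) xor does (w ≟F x)
    ends-of (inj₁ refl) = refl
    ends-of (inj₂ refl) = xor-comm (does (w ≟F x)) _

  -- Boundaries of consecutive steps cancel at the vertex between them.
  ∂-parity : ∀ {u v} (P : Walk G u v) x → ∂ (parity P) x ≡ does (u ≟F x) xor does (v ≟F x)
  ∂-parity {u} []                 x = trans (sum-zero {nE} λ _ → refl) (sym (xor-same (does (u ≟F x))))
  ∂-parity {u} {v} (step {w = w} e j P) x = begin
    ∂ (λ g → does (g ≟F e) xor parity P g) x                  ≡⟨ ∂-xor (λ g → does (g ≟F e)) (parity P) x ⟩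
    ∂ (λ g → does (g ≟F e)) x xor ∂ (parity P) x              ≡⟨ cong₂ _xor_ (∂-edge j x) (∂-parity P x) ⟩
    ([ u ] xor [ w ]) xor ([ w ] xor [ v ])                   ≡⟨ CommutativeRing.+-assoc xor-∧-commutativeRing [ u ] _ _ ⟩
    [ u ] xor ([ w ] xor ([ w ] xor [ v ]))                   ≡⟨ cong ([ u ] xor_) (xor-cancel [ w ] [ v ]) ⟩
    [ u ] xor [ v ]                                           ∎
    where
    open ≡-Reasoning
    [_] : Fin nV → Bool
    [ y ] = does (y ≟F x)

  sumD : (Dart G → Bool) → Bool
  sumD s = sum (λ e → s (e , true)) xor sum (λ e → s (e , false))

  sumD-cong : ∀ {s t} → (∀ d → s d ≡ t d) → sumD s ≡ sumD t
  sumD-cong eq = cong₂ _xor_ (sum-cong-≗ λ e → eq (e , true)) (sum-cong-≗ λ e → eq (e , false))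

  sumD-comm : ∀ (t : Dart G → Dart G → Bool) → sumD (λ x → sumD (t x)) ≡ sumD (λ y → sumD λ x → t x y)
  sumD-comm t = begin
    sumD (λ x → sumD (t x))
      ≡⟨ cong₂ _xor_ (∑-distrib-+ _ (λ e → sum λ e′ → t (e , true) (e′ , false)))
                     (∑-distrib-+ _ (λ e → sum λ e′ → t (e , false) (e′ , false))) ⟩
    (S true true xor S true false) xor (S false true xor S false false)
      ≡⟨ xor-interchange (S true true) _ _ _ ⟩
    (S true true xor S false true) xor (S true false xor S false false)
      ≡⟨ cong₂ _xor_ (cong₂ _xor_ (comm true true) (comm false true)) (cong₂ _xor_ (comm true false) (comm false false)) ⟩
    (S′ true true xor S′ false true) xor (S′ true false xor S′ false false)
      ≡⟨ cong₂ _xor_ (∑-distrib-+ _ (λ e → sum λ e′ → t (e′ , false) (e , true)))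
                     (∑-distrib-+ _ (λ e → sum λ e′ → t (e′ , false) (e , false))) ⟨
    sumD (λ y → sumD λ x → t x y) ∎
    where
    open ≡-Reasoning
    S S′ : Bool → Bool → Bool
    S  b c = sum λ e → sum λ e′ → t (e , b) (e′ , c)
    S′ b c = sum λ e → sum λ e′ → t (e′ , b) (e , c)
    comm : ∀ b c → S b c ≡ S′ b c
    comm b c = ∑-comm (λ e e′ → t (e , b) (e′ , c))

  sumD-δ : ∀ (s : Dart G → Bool) d → sumD (λ x → s x ∧ does (_≟D_ G x d)) ≡ s d
  sumD-δ s (e , b) = trans (cong₂ _xor_ (slice true) (slice false)) (total b)
    where
    indicator : ∀ c g → does (_≟D_ G (g , c) (e , b)) ≡ does (b ≟B c) ∧ does (g ≟F e)
    indicator c g = does-⇔ (_≟D_ G (g , c) (e , b)) ((b ≟B c) ×-dec (g ≟F e))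
      (λ { refl → refl , refl }) (λ { (refl , refl) → refl })
    term : ∀ c g → s (g , c) ∧ does (_≟D_ G (g , c) (e , b)) ≡ (s (g , c) ∧ does (b ≟B c)) ∧ does (g ≟F e)
    term c g = trans (cong (s (g , c) ∧_) (indicator c g)) (sym (∧-assoc (s (g , c)) _ _))
    slice : ∀ c → sum (λ g → s (g , c) ∧ does (_≟D_ G (g , c) (e , b))) ≡ s (e , c) ∧ does (b ≟B c)
    slice c = trans (sum-cong-≗ (term c)) (sum-δ (λ g → s (g , c) ∧ does (b ≟B c)) e)
    total : ∀ b → (s (e , true) ∧ does (b ≟B true)) xor (s (e , false) ∧ does (b ≟B false)) ≡ s (e , b)
    total true  = trans (cong₂ _xor_ (∧-identityʳ (s (e , true))) (∧-zeroʳ (s (e , false)))) (xor-identityʳ (s (e , true)))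
    total false = cong₂ _xor_ (∧-zeroʳ (s (e , true))) (∧-identityʳ (s (e , false)))

module Surface (G : Graph) (ρ : RotationSystem G) where
  open Graph G
  open RotationSystem ρ

  φ : Dart G → Dart G
  φ d = σ (reverse G d)

  σ-injective : ∀ {d d′} → σ d ≡ σ d′ → d ≡ d′
  σ-injective {d} {d′} eq = trans (sym (invʳ d)) (trans (cong σ⁻¹ eq) (invʳ d′))

  φ-injective : ∀ {d d′} → φ d ≡ φ d′ → d ≡ d′
  φ-injective {d} {d′} eq = trans (sym (reverse-involutive G d))
    (trans (cong (reverse G) (σ-injective eq)) (reverse-involutive G d′))

  module Faces = Orbits G φ φ-injective

  -- Reindexing along a permutation: insert the indicator of `x ≡ σ d`, exchange the two sums, and
  -- evaluate the inner one at `σ⁻¹ x`.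
  sumD-σ : ∀ s → sumD G (s ∘ σ) ≡ sumD G s
  sumD-σ s = begin
    sumD G (λ d → s (σ d))                                           ≡⟨ sumD-cong G (λ d → sumD-δ G s (σ d)) ⟨
    sumD G (λ d → sumD G λ x → s x ∧ does (_≟D_ G x (σ d)))          ≡⟨ sumD-comm G (λ d x → s x ∧ does (_≟D_ G x (σ d))) ⟩
    sumD G (λ x → sumD G λ d → s x ∧ does (_≟D_ G x (σ d)))          ≡⟨ sumD-cong G (λ x → sumD-cong G (move′ x)) ⟩
    sumD G (λ x → sumD G λ d → s x ∧ does (_≟D_ G d (σ⁻¹ x)))        ≡⟨ sumD-cong G (λ x → sumD-δ G (λ _ → s x) (σ⁻¹ x)) ⟩
    sumD G s                                                         ∎
    where
    open ≡-Reasoning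
    move : ∀ x d → does (_≟D_ G x (σ d)) ≡ does (_≟D_ G d (σ⁻¹ x))
    move x d = does-⇔ (_≟D_ G x (σ d)) (_≟D_ G d (σ⁻¹ x))
      (λ { refl → sym (invʳ d) }) (λ { refl → sym (invˡ x) })
    move′ : ∀ x d → s x ∧ does (_≟D_ G x (σ d)) ≡ s x ∧ does (_≟D_ G d (σ⁻¹ x))
    move′ x d = cong (s x ∧_) (move x d)

  -- For a colouring of the faces, these are the edges with differently coloured sides.
  edgeDiff : (Dart G → Bool) → Fin nE → Bool
  edgeDiff f e = f (e , true) xor f (e , false)

  Invariant : (Dart G → Bool) → Set
  Invariant f = ∀ d → f (φ d) ≡ f d

  module _ {f : Dart G → Bool} (inv : Invariant f) where

    -- `σ d` is the `φ`-successor of `reverse G d`. Hence turning past `d` at its tail changes the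
    -- colour exactly when the edge of `d` separates the colours.
    reverse≡σ : ∀ d → f (reverse G d) ≡ f (σ d)
    reverse≡σ d = trans (sym (inv (reverse G d))) (cong (f ∘ σ) (reverse-involutive G d))

    -- At `v` the colours on the two sides of the edge of `d` are those of `d` and `σ d`, so the sum
    -- over the darts at `v` cancels against its own rotation.
    ∂-edgeDiff : ∀ v → ∂ G (edgeDiff f) v ≡ false
    ∂-edgeDiff v = begin
      ∂ G (edgeDiff f) v                              ≡⟨ sum-cong-≗ (λ e → expand (f (e , true)) (f (e , false)) _ _) ⟩
      sum (λ e → (s (e , true) xor s (e , false)) xor (t (e , true) xor t (e , false)))
        ≡⟨ ∑-distrib-+ (λ e → s (e , true) xor s (e , false)) (λ e → t (e , true) xor t (e , false)) ⟩
      sum (λ e → s (e , true) xor s (e , false)) xor sum (λ e → t (e , true) xor t (e , false))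
        ≡⟨ cong₂ _xor_ (∑-distrib-+ (λ e → s (e , true)) (λ e → s (e , false)))
                       (∑-distrib-+ (λ e → t (e , true)) (λ e → t (e , false))) ⟩
      sumD G s xor sumD G t                           ≡⟨ cong (sumD G s xor_) (trans (sumD-cong G t≡s∘σ) (sumD-σ s)) ⟩
      sumD G s xor sumD G s                           ≡⟨ xor-same (sumD G s) ⟩
      false                                           ∎
      where
      open ≡-Reasoning
      s t : Dart G → Bool
      s d = f d ∧ leaves G d v
      t d = f (reverse G d) ∧ leaves G d v
      t≡s∘σ : ∀ d → t d ≡ s (σ d)
      t≡s∘σ d = cong₂ _∧_ (reverse≡σ d) (cong (λ u → does (u ≟F v)) (sym (local d)))
      expand : ∀ p q a b → (p xor q) ∧ (a xor b) ≡ ((p ∧ a) xor (q ∧ b)) xor ((q ∧ a) xor (p ∧ b))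
      expand false false a b = refl
      expand false true  a b = sym (trans (xor-comm b _) (cong (_xor b) (xor-identityʳ a)))
      expand true  false a b = cong (_xor b) (sym (xor-identityʳ a))
      expand true  true  a b = sym (trans (cong ((a xor b) xor_) refl) (xor-same (a xor b)))

    module _ (flat : ∀ d → f (reverse G d) ≡ f d) where

      constant-at : ∀ {d d′} → tail G d ≡ tail G d′ → f d ≡ f d′
      constant-at {d} {d′} eq = let (k , kd≡d′) = cyclic d d′ eq in trans (sym (orbit k)) (cong f kd≡d′)
        where
        orbit : ∀ k → f (iter G σ k d) ≡ f d
        orbit zero    = refl
        orbit (suc k) = trans (sym (reverse≡σ _)) (trans (flat _) (orbit k))

      -- Neither turning at a vertex nor crossing an edge changes the colour. In a connected graph,
      -- `edgeDiff` thus vanishes only on the two constant colourings.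
      constant-along : ∀ {u v} → Walk G u v → ∀ {d d′} → tail G d ≡ u → tail G d′ ≡ v → f d ≡ f d′
      constant-along []           du d′u = constant-at (trans du (sym d′u))
      constant-along {u} (step {w = w} e j P) {d} {d′} du d′v = begin
        f d                        ≡⟨ constant-at (trans du (sym (tail-dartAt G j))) ⟩
        f (dartAt G e u)           ≡⟨ flat (dartAt G e u) ⟨
        f (reverse G (dartAt G e u)) ≡⟨ cong f (reverse-dartAt G j) ⟩
        f (dartAt G e w)           ≡⟨ constant-along P (tail-dartAt G (Joins-sym j)) d′v ⟩
        f d′                       ∎
        where
        open ≡-Reasoning
        Joins-sym : ∀ {e u w} → Joins G e u w → Joins G e w u
        Joins-sym (inj₁ x) = inj₂ x
        Joins-sym (inj₂ x) = inj₁ x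

  -- Counting with Euler's formula: closed chains bound

  module _ (connected : Connected G) (root : Fin nV) (d₀ : Dart G) where

    private
      F : ℕ
      F = faceCount G ρ

      faceFun : Vec Bool F → Dart G → Bool
      faceFun g d = spread (_≟D_ G) Faces.isMin (allDarts G) g (Faces.minRep d)

      faceFun-invariant : ∀ g → Invariant (faceFun g)
      faceFun-invariant g d = cong (spread (_≟D_ G) Faces.isMin (allDarts G) g)
        (sym (Faces.minRep-Reach (1 , refl)))

      faceFun-injective : ∀ g g′ → (∀ d → faceFun g d ≡ faceFun g′ d) → g ≡ g′
      faceFun-injective g g′ eq = spread-injective (_≟D_ G) Faces.isMin (allDarts G) (allDarts-unique G) g g′
        λ d _ min → subst
          (λ m → spread (_≟D_ G) Faces.isMin (allDarts G) g m ≡ spread (_≟D_ G) Faces.isMin (allDarts G) g′ m)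
          (Faces.minRep-isMin min) (eq d)

      -- A section of `∂` away from `root`: one walk to `root` for every vertex selected by `h`.
      walks : Vec Bool nV → Fin nE → Bool
      walks h e = sum λ i → lookup h i ∧ parity G (connected i root) e

      ∂-walks : ∀ h x → root ≢ x → ∂ G (walks h) x ≡ lookup h x
      ∂-walks h x root≢x = begin
        ∂ G (walks h) x                                                     ≡⟨ ∂-sum G (lookup h) (λ i → parity G (connected i root)) x ⟩
        sum (λ i → lookup h i ∧ ∂ G (parity G (connected i root)) x)        ≡⟨ sum-cong-≗ (λ i → cong (lookup h i ∧_) (at i)) ⟩
        sum (λ i → lookup h i ∧ does (i ≟F x))                              ≡⟨ sum-δ (lookup h) x ⟩
        lookup h x                                                          ∎
        where
        open ≡-Reasoning
        at : ∀ i → ∂ G (parity G (connected i root)) x ≡ does (i ≟F x)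
        at i = trans (∂-parity G (connected i root) x)
          (trans (cong (does (i ≟F x) xor_) (dec-false (root ≟F x) root≢x)) (xor-identityʳ _))

      total : Vec Bool nV → Vec Bool F → Fin nE → Bool
      total h g e = walks h e xor edgeDiff (faceFun g) e

      ∂-total : ∀ h g x → root ≢ x → ∂ G (total h g) x ≡ lookup h x
      ∂-total h g x root≢x = begin
        ∂ G (total h g) x                                      ≡⟨ ∂-xor G (walks h) (edgeDiff (faceFun g)) x ⟩
        ∂ G (walks h) x xor ∂ G (edgeDiff (faceFun g)) x       ≡⟨ cong₂ _xor_ (∂-walks h x root≢x) (∂-edgeDiff inv x) ⟩
        lookup h x xor false                                   ≡⟨ xor-identityʳ _ ⟩
        lookup h x                                             ∎
        where
        open ≡-Reasoning
        inv = faceFun-invariant g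

      -- The last two bits detect the kernel: the walk from root to itself and the constant colouring.
      Ψ : Vec Bool (nV + F) → Vec Bool (nE + 2)
      Ψ v = tabulate (total (take nV v) (drop nV v)) ++ (lookup (take nV v) root ∷ faceFun (drop nV v) d₀ ∷ [])

      -- Face boundaries are closed, so the boundary away from `root` recovers `h`. Then no edge
      -- separates the sum of the two colourings, which is therefore constant, and its value at `d₀`
      -- is zero.
      total-injective : ∀ h h′ g g′ → (∀ e → total h g e ≡ total h′ g′ e) → lookup h root ≡ lookup h′ root →
        faceFun g d₀ ≡ faceFun g′ d₀ → h ≡ h′ × g ≡ g′
      total-injective h h′ g g′ total≡ root≡ d₀≡ = h≡h′ , faceFun-injective g g′ faceFun≡
        where
        h≡h′ : h ≡ h′
        h≡h′ = lookup-injective at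
          where
          at : ∀ x → lookup h x ≡ lookup h′ x
          at x with root ≟F x
          ... | yes refl   = root≡
          ... | no  root≢x = trans (sym (∂-total h g x root≢x))
            (trans (∂-cong G total≡ x) (∂-total h′ g′ x root≢x))
        k : Dart G → Bool
        k d = faceFun g d xor faceFun g′ d
        k-invariant : Invariant k
        k-invariant d = cong₂ _xor_ (faceFun-invariant g d) (faceFun-invariant g′ d)
        edgeDiff≡ : ∀ e → edgeDiff (faceFun g) e ≡ edgeDiff (faceFun g′) e
        edgeDiff≡ e = begin
          edgeDiff (faceFun g) e                                ≡⟨ xor-cancel (walks h e) _ ⟨
          walks h e xor total h g e                             ≡⟨ cong₂ _xor_ (cong (λ h → walks h e) h≡h′) (total≡ e) ⟩
          walks h′ e xor total h′ g′ e                          ≡⟨ xor-cancel (walks h′ e) _ ⟩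
          edgeDiff (faceFun g′) e                               ∎
          where open ≡-Reasoning
        k-flat : ∀ d → k (reverse G d) ≡ k d
        k-flat (e , true)  = xor-rearrange (faceFun g (e , true)) (faceFun g (e , false))
          (faceFun g′ (e , true)) (faceFun g′ (e , false)) (edgeDiff≡ e)
        k-flat (e , false) = sym (k-flat (e , true))
        faceFun≡ : ∀ d → faceFun g d ≡ faceFun g′ d
        faceFun≡ d = xor≡false⇒≡ (trans
          (constant-along k-invariant k-flat (connected (tail G d) (tail G d₀)) refl refl)
          (trans (cong (faceFun g d₀ xor_) (sym d₀≡)) (xor-same (faceFun g d₀))))

      Ψ-injective : Injective _≡_ _≡_ Ψ
      Ψ-injective {v} {w} eq =
        let (eqE , eq₂) = ++-injective (tabulate (total (take nV v) (drop nV v)))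
              (tabulate (total (take nV w) (drop nV w))) eq
            (h≡ , g≡) = total-injective (take nV v) (take nV w) (drop nV v) (drop nV w)
              (tabulate-injective eqE) (cong (λ z → lookup z zero) eq₂) (cong (λ z → lookup z (suc zero)) eq₂)
        in trans (sym (take++drop≡id nV v)) (trans (cong₂ _++_ h≡ g≡) (take++drop≡id nV w))

    -- A preimage under `Ψ` of the closed chain `P + Q` has `h` zero away from `root`, because `∂`
    -- reads off `h` there; what remains is a face colouring.
    jordan : nV + F ≡ nE + 2 → ∀ {u v} (P Q : Walk G u v) →
      ∃ λ f → Invariant f × (∀ e → edgeDiff f e ≡ parity G P e xor parity G Q e)
    jordan euler {u} {v} P Q = from-preimage (Vec-injective⇒surjective euler Ψ Ψ-injective target)
      where
      Z : Fin nE → Bool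
      Z e = parity G P e xor parity G Q e
      target : Vec Bool (nE + 2)
      -- Surjectivity leaves both extra bits to choice: the first `false` kills `h` at `root`, the
      -- second normalises the colouring.
      target = tabulate Z ++ (false ∷ false ∷ [])
      ∂Z : ∀ x → ∂ G Z x ≡ false
      ∂Z x = trans (∂-xor G (parity G P) (parity G Q) x)
        (trans (cong₂ _xor_ (∂-parity G P x) (∂-parity G Q x)) (xor-same (does (u ≟F x) xor does (v ≟F x))))
      from-preimage : (∃ λ y → Ψ y ≡ target) → ∃ λ f → Invariant f × (∀ e → edgeDiff f e ≡ Z e)
      from-preimage (y , eq) = faceFun g , faceFun-invariant g ,
        λ e → trans (sym (cong (_xor edgeDiff (faceFun g) e) (walks-zero e))) (total≡Z e)
        where
        h : Vec Bool nV
        h = take nV y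
        g : Vec Bool F
        g = drop nV y
        parts = ++-injective (tabulate (total h g)) (tabulate Z) eq
        total≡Z : ∀ e → total h g e ≡ Z e
        total≡Z = tabulate-injective (proj₁ parts)
        h-zero : ∀ x → lookup h x ≡ false
        h-zero x with root ≟F x
        ... | yes refl   = cong (λ z → lookup z zero) (proj₂ parts)
        ... | no  root≢x = trans (sym (∂-total h g x root≢x)) (trans (∂-cong G total≡Z x) (∂Z x))
        walks-zero : ∀ e → walks h e ≡ false
        walks-zero e = sum-zero λ i → cong (_∧ parity G (connected i root) e) (h-zero i)

-- Walks, paths and trees

module _ (G : Graph) where
  open Graph G

  open DecMembership (_≟F_ {nE}) using () renaming (_∈?_ to _∈E?_)
  open DecMembership (_≟F_ {nV}) using () renaming (_∈?_ to _∈V?_)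

  Incident : Fin nE → Fin nV → Set
  Incident e x = proj₁ (ends e) ≡ x ⊎ proj₂ (ends e) ≡ x

  Joins-sym : ∀ {e u w} → Joins G e u w → Joins G e w u
  Joins-sym = Sum.swap

  Joins⇒Incident : ∀ {e u w} → Joins G e u w → Incident e u
  Joins⇒Incident (inj₁ refl) = inj₁ refl
  Joins⇒Incident (inj₂ refl) = inj₂ refl

  Joins⇒≢ : ∀ {e u w} → Joins G e u w → u ≢ w
  Joins⇒≢ (inj₁ refl) = loopless _
  Joins⇒≢ (inj₂ refl) = loopless _ ∘ sym

  Incident-ends : ∀ {e u w x} → Joins G e u w → Incident e x → x ≡ u ⊎ x ≡ w
  Incident-ends (inj₁ refl) (inj₁ refl) = inj₁ refl
  Incident-ends (inj₁ refl) (inj₂ refl) = inj₂ refl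
  Incident-ends (inj₂ refl) (inj₁ refl) = inj₂ refl
  Incident-ends (inj₂ refl) (inj₂ refl) = inj₁ refl

  source∈ : ∀ {u v} (P : Walk G u v) → u ∈ walkVerts G P
  source∈ []           = here refl
  source∈ (step _ _ _) = here refl

  target∈ : ∀ {u v} (P : Walk G u v) → v ∈ walkVerts G P
  target∈ []           = here refl
  target∈ (step _ _ P) = there (target∈ P)

  Incident⇒∈ : ∀ {u v} (P : Walk G u v) {e x} → e ∈ walkEdges G P → Incident e x → x ∈ walkVerts G P
  Incident⇒∈ (step e j P) (here refl) i with Incident-ends j i
  ... | inj₁ refl = here refl
  ... | inj₂ refl = there (source∈ P)
  Incident⇒∈ (step e j P) (there e∈) i = there (Incident⇒∈ P e∈ i)

  -- Irrelevance of `u ≢ v` makes first edges obtained from different proofs definitionally equal.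
  first : ∀ {u v} (P : Walk G u v) → .(u ≢ v) → Fin nE
  first []           u≢v = ⊥-elim-irr (u≢v refl)
  first (step e _ _) _   = e

  lastAfter : ∀ {u v} → Fin nE → Walk G u v → Fin nE
  lastAfter e []            = e
  lastAfter _ (step e _ P)  = lastAfter e P

  last : ∀ {u v} (P : Walk G u v) → .(u ≢ v) → Fin nE
  last []           u≢v = ⊥-elim-irr (u≢v refl)
  last (step e _ P) _   = lastAfter e P

  first∈ : ∀ {u v} (P : Walk G u v) (u≢v : u ≢ v) → first P u≢v ∈ walkEdges G P
  first∈ []           u≢v = ⊥-elim (u≢v refl)
  first∈ (step _ _ _) _   = here refl

  lastAfter∈ : ∀ {u w v} {e} (j : Joins G e u w) (P : Walk G w v) → lastAfter e P ∈ walkEdges G (step e j P)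
  lastAfter∈ _ []            = here refl
  lastAfter∈ _ (step e j P)  = there (lastAfter∈ j P)

  last∈ : ∀ {u v} (P : Walk G u v) (u≢v : u ≢ v) → last P u≢v ∈ walkEdges G P
  last∈ []           u≢v = ⊥-elim (u≢v refl)
  last∈ (step e j P) _   = lastAfter∈ j P

  first-joins : ∀ {u v} (P : Walk G u v) (u≢v : u ≢ v) → ∃ λ w → Joins G (first P u≢v) u w
  first-joins []           u≢v = ⊥-elim (u≢v refl)
  first-joins (step e j P) _   = _ , j

  lastAfter-joins : ∀ {u w v} {e} (j : Joins G e u w) (P : Walk G w v) → ∃ λ x → Joins G (lastAfter e P) v x
  lastAfter-joins j []            = _ , Joins-sym j
  lastAfter-joins _ (step e j P)  = lastAfter-joins j P

  last-joins : ∀ {u v} (P : Walk G u v) (u≢v : u ≢ v) → ∃ λ x → Joins G (last P u≢v) v x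
  last-joins []           u≢v = ⊥-elim (u≢v refl)
  last-joins (step e j P) _   = lastAfter-joins j P

  ∈⇒Incident : ∀ {u v} (P : Walk G u v) {x} → u ≢ v → x ∈ walkVerts G P → ∃ λ e → e ∈ walkEdges G P × Incident e x
  ∈⇒Incident {v = v} P {x} u≢v x∈ = either (start P x∈)
    where
    start : ∀ {u v} (P : Walk G u v) {x} → x ∈ walkVerts G P → x ≡ v ⊎ ∃ λ e → e ∈ walkEdges G P × Incident e x
    start []           (here refl) = inj₁ refl
    start (step e j P) (here refl) = inj₂ (e , here refl , Joins⇒Incident j)
    start (step e j P) (there x∈)  = Sum.map₂ (λ (g , g∈ , i) → g , there g∈ , i) (start P x∈)
    either : (x ≡ v ⊎ ∃ λ e → e ∈ walkEdges G P × Incident e x) → ∃ λ e → e ∈ walkEdges G P × Incident e x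
    either (inj₁ refl) = last P u≢v , last∈ P u≢v , Joins⇒Incident (proj₂ (last-joins P u≢v))
    either (inj₂ r)    = r

  source-fresh : ∀ {u w v e} (j : Joins G e u w) (P : Walk G w v) → IsPath G (step e j P) → u ∉ walkVerts G P
  source-fresh _ _ (u∉ ∷ _) = All¬⇒¬Any u∉

  edge-fresh : ∀ {u w v e} (j : Joins G e u w) (P : Walk G w v) → IsPath G (step e j P) → e ∉ walkEdges G P
  edge-fresh j P path e∈ = source-fresh j P path (Incident⇒∈ P e∈ (Joins⇒Incident j))

  path-tail : ∀ {u w v e} (j : Joins G e u w) (P : Walk G w v) → IsPath G (step e j P) → IsPath G P
  path-tail _ _ (_ ∷ path) = path

  path⇒uniqueEdges : ∀ {u v} (P : Walk G u v) → IsPath G P → Unique (walkEdges G P)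
  path⇒uniqueEdges []           _    = []
  path⇒uniqueEdges (step e j P) path = ¬Any⇒All¬ _ (edge-fresh j P path) ∷ path⇒uniqueEdges P (path-tail j P path)

  first-unique : ∀ {u v} (P : Walk G u v) (u≢v : u ≢ v) → IsPath G P →
    ∀ {g} → g ∈ walkEdges G P → Incident g u → g ≡ first P u≢v
  first-unique (step e j P) _ path (here eq)  i = eq
  first-unique (step e j P) _ path (there g∈) i = ⊥-elim (source-fresh j P path (Incident⇒∈ P g∈ i))

  lastAfter-unique : ∀ {u w v e} (j : Joins G e u w) (P : Walk G w v) → IsPath G (step e j P) →
    ∀ {g} → g ∈ walkEdges G (step e j P) → Incident g v → g ≡ lastAfter e P
  lastAfter-unique j []             path (here eq)   i = eq
  lastAfter-unique j (step e′ j′ P) path (there g∈)  i = lastAfter-unique j′ P (path-tail j (step e′ j′ P) path) g∈ i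
  lastAfter-unique j (step e′ j′ P) path (here refl) i with Incident-ends j i
  ... | inj₁ refl = ⊥-elim (source-fresh j (step e′ j′ P) path (there (target∈ P)))
  ... | inj₂ refl = ⊥-elim (source-fresh j′ P (path-tail j (step e′ j′ P) path) (target∈ P))

  last-unique : ∀ {u v} (P : Walk G u v) (u≢v : u ≢ v) → IsPath G P →
    ∀ {g} → g ∈ walkEdges G P → Incident g v → g ≡ last P u≢v
  last-unique []           u≢v = ⊥-elim (u≢v refl)
  last-unique (step e j P) _   = lastAfter-unique j P

  trivial-path : ∀ {u} (P : Walk G u u) → IsPath G P → ∀ {x} → x ∈ walkVerts G P → x ≡ u
  trivial-path []           _    (here eq) = eq
  trivial-path (step e j P) path _         = ⊥-elim (source-fresh j P path (target∈ P))

  -- The predicate is a parameter because connection is needed both in a tree and in a tree minus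
  -- one edge.
  Conn : (Fin nE → Set) → Fin nV → Fin nV → Set
  Conn Q u v = Σ (Walk G u v) λ W → All Q (walkEdges G W)

  module _ {Q : Fin nE → Set} where

    Conn-step : ∀ {e u w v} → Joins G e u w → Q e → Conn Q w v → Conn Q u v
    Conn-step j q (W , qs) = step _ j W , q ∷ qs

    Conn-trans : ∀ {u v w} → Conn Q u v → Conn Q v w → Conn Q u w
    Conn-trans ([]         , [])     c = c
    Conn-trans (step e j W , q ∷ qs) c = Conn-step j q (Conn-trans (W , qs) c)

    Conn-sym : ∀ {u v} → Conn Q u v → Conn Q v u
    Conn-sym ([]         , [])     = [] , []
    Conn-sym (step e j W , q ∷ qs) = Conn-trans (Conn-sym (W , qs)) (Conn-step (Joins-sym j) q ([] , []))

    suffix : ∀ {u v} (P : Walk G u v) {x} → x ∈ walkVerts G P → IsPath G P → All Q (walkEdges G P) →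
      Σ (Walk G x v) λ P′ → IsPath G P′ × All Q (walkEdges G P′)
    suffix []           (here refl) path qs       = [] , path , qs
    suffix (step e j P) (here refl) path qs       = step e j P , path , qs
    suffix (step e j P) (there x∈)  path (q ∷ qs) = suffix P x∈ (path-tail j P path) qs

    Conn⇒path : ∀ {u v} → Conn Q u v → Σ (Walk G u v) λ P → IsPath G P × All Q (walkEdges G P)
    Conn⇒path ([] , [])                  = [] , ([] ∷ []) , []
    Conn⇒path {u} (step e j W , q ∷ qs) with Conn⇒path (W , qs)
    ... | P , path , qs′ with u ∈V? walkVerts G P
    ...   | yes u∈ = suffix P u∈ path qs′
    ...   | no  u∉ = step e j P , (¬Any⇒All¬ _ u∉ ∷ path) , q ∷ qs′

    Conn-trans-∈ : ∀ {u v w} (c : Conn Q u v) (c′ : Conn Q v w) {x} → x ∈ walkVerts G (proj₁ (Conn-trans c c′)) →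
      x ∈ walkVerts G (proj₁ c) ⊎ x ∈ walkVerts G (proj₁ c′)
    Conn-trans-∈ ([]         , [])     c′ x∈          = inj₂ x∈
    Conn-trans-∈ (step e j W , q ∷ qs) c′ (here refl) = inj₁ (here refl)
    Conn-trans-∈ (step e j W , q ∷ qs) c′ (there x∈)  = Sum.map₁ there (Conn-trans-∈ (W , qs) c′ x∈)

    Conn-sym-∈ : ∀ {u v} (c : Conn Q u v) {x} → x ∈ walkVerts G (proj₁ (Conn-sym c)) → x ∈ walkVerts G (proj₁ c)
    Conn-sym-∈ ([]         , [])     x∈ = x∈
    Conn-sym-∈ (step e j W , q ∷ qs) x∈ = Sum.[ there ∘ Conn-sym-∈ (W , qs) , at-step ]
      (Conn-trans-∈ (Conn-sym (W , qs)) (Conn-step (Joins-sym j) q ([] , [])) x∈)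
      where
      at-step : ∀ {x} → x ∈ (_ ∷ _ ∷ []) → x ∈ walkVerts G (step e j W)
      at-step (here refl)         = there (source∈ W)
      at-step (there (here refl)) = here refl

    Conn-trans-edges : ∀ {u v w} (c : Conn Q u v) (c′ : Conn Q v w) {e} → e ∈ walkEdges G (proj₁ (Conn-trans c c′)) →
      e ∈ walkEdges G (proj₁ c) ⊎ e ∈ walkEdges G (proj₁ c′)
    Conn-trans-edges ([]         , [])     c′ e∈          = inj₂ e∈
    Conn-trans-edges (step e j W , q ∷ qs) c′ (here refl) = inj₁ (here refl)
    Conn-trans-edges (step e j W , q ∷ qs) c′ (there e∈)  = Sum.map₁ there (Conn-trans-edges (W , qs) c′ e∈)

    Conn-sym-edges : ∀ {u v} (c : Conn Q u v) {e} → e ∈ walkEdges G (proj₁ (Conn-sym c)) → e ∈ walkEdges G (proj₁ c)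
    Conn-sym-edges ([]         , [])     e∈ = e∈
    Conn-sym-edges (step e j W , q ∷ qs) e∈ = Sum.[ there ∘ Conn-sym-edges (W , qs) , (λ { (here refl) → here refl }) ]
      (Conn-trans-edges (Conn-sym (W , qs)) (Conn-step (Joins-sym j) q ([] , [])) e∈)

  module _ (ET : Subset nE) (acyclic : ¬ HasCycleIn G ET) where

    Avoids : Fin nE → Fin nE → Set
    Avoids e g = g ∈S ET × g ≢ e

    -- Every edge of an acyclic set is a bridge: a way round it, be it only a parallel edge, would
    -- close a cycle.
    no-bypass : ∀ {e x y} → e ∈S ET → Joins G e x y → ¬ Conn (Avoids e) y x
    no-bypass {e} {x} {y} e∈ET j c =
      let (P , path , qs) = Conn⇒path c
      in acyclic (x , y , e , j , P
        , All.map (λ (_ , g≢e) → g≢e ∘ sym) qs ∷ path⇒uniqueEdges P path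
        , path
        , e∈ET ∷ All.map proj₁ qs)

    avoiding : ∀ {u v e} (W : Walk G u v) → UsesOnly G ET W → e ∉ walkEdges G W → Conn (Avoids e) u v
    avoiding W only e∉ = W , All.tabulate λ g∈ → All.lookup only g∈ , λ { refl → e∉ g∈ }

    split : ∀ {u v} (P : Walk G u v) → IsPath G P → UsesOnly G ET P → ∀ {e} → e ∈ walkEdges G P →
      ∃ λ x → ∃ λ y → Joins G e x y × Conn (Avoids e) u x × Conn (Avoids e) y v
    split (step e j P) path (_ ∷ only) (here refl) = _ , _ , j , ([] , []) , avoiding P only (edge-fresh j P path)
    split (step e j P) path (q ∷ only) (there g∈)  =
      let (x , y , j′ , before , after) = split P (path-tail j P path) only g∈
      in x , y , j′ , Conn-step j (q , λ { refl → edge-fresh j P path g∈ }) before , after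

    -- If `W` missed `e`, then `W` and the parts of `P` before and after `e` would bypass `e`. This
    -- is the form in which uniqueness of tree paths is used.
    covers-edge : ∀ {u v} (P W : Walk G u v) → IsPath G P → UsesOnly G ET P → UsesOnly G ET W →
      ∀ {e} → e ∈ walkEdges G P → e ∈ walkEdges G W
    covers-edge P W path onlyP onlyW {e} e∈ with e ∈E? walkEdges G W
    ... | yes e∈W = e∈W
    ... | no  e∉W =
      let (x , y , j , before , after) = split P path onlyP e∈
      in ⊥-elim (no-bypass (All.lookup onlyP e∈) j
           (Conn-trans after (Conn-trans (Conn-sym (avoiding W onlyW e∉W)) before)))

    covers-vertex : ∀ {u v} (P W : Walk G u v) → u ≢ v → IsPath G P → UsesOnly G ET P → UsesOnly G ET W →
      ∀ {x} → x ∈ walkVerts G P → x ∈ walkVerts G W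
    covers-vertex P W u≢v path onlyP onlyW x∈ =
      let (e , e∈ , i) = ∈⇒Incident P u≢v x∈
      in Incident⇒∈ W (covers-edge P W path onlyP onlyW e∈) i

    -- Two paths leaving a in T along different edges form the path b…a…c.
    branch-or-through : ∀ {a b c} (P : Walk G a b) (Q : Walk G a c) (W : Walk G b c) (a≢b : a ≢ b) (a≢c : a ≢ c) →
      IsPath G P → IsPath G Q → UsesOnly G ET P → UsesOnly G ET Q → UsesOnly G ET W →
      first P a≢b ≡ first Q a≢c ⊎ a ∈ walkVerts G W
    branch-or-through {a} P Q W a≢b a≢c pathP pathQ onlyP onlyQ onlyW
      with first P a≢b ≟F first Q a≢c | a ∈V? walkVerts G W
    ... | yes eq | _      = inj₁ eq
    ... | no  _  | yes a∈ = inj₂ a∈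
    branch-or-through [] Q W a≢b a≢c pathP pathQ onlyP onlyQ onlyW | no _ | no _ = ⊥-elim (a≢b refl)
    branch-or-through (step e j P) Q W a≢b a≢c pathP pathQ (e∈ET ∷ onlyP) onlyQ onlyW | no ≢first | no a∉ =
      ⊥-elim (no-bypass e∈ET j (Conn-trans (avoiding P onlyP (edge-fresh j P pathP))
        (Conn-trans (avoiding W onlyW λ e∈ → a∉ (Incident⇒∈ W e∈ (Joins⇒Incident j)))
          (Conn-sym (avoiding Q onlyQ λ e∈ → ≢first (first-unique Q a≢c pathQ e∈ (Joins⇒Incident j)))))))

-- Sides of a cycle

module _ (G : Graph) where
  open Graph G

  parity-∉ : ∀ {u v} (P : Walk G u v) {e} → e ∉ walkEdges G P → parity G P e ≡ false
  parity-∉ []           _  = refl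
  parity-∉ (step g j P) {e} e∉ = cong₂ _xor_ (dec-false (e ≟F g) (e∉ ∘ here)) (parity-∉ P (e∉ ∘ there))

  parity-∈ : ∀ {u v} (P : Walk G u v) {e} → Unique (walkEdges G P) → e ∈ walkEdges G P → parity G P e ≡ true
  parity-∈ (step g j P) {e} (g∉ ∷ _) (here refl) =
    cong₂ _xor_ (dec-true (e ≟F e) refl) (parity-∉ P (All¬⇒¬Any g∉))
  parity-∈ (step g j P) {e} (g∉ ∷ u) (there e∈)  =
    cong₂ _xor_ (dec-false (e ≟F g) λ { refl → All.lookup g∉ e∈ refl }) (parity-∈ P u e∈)

module Potentials (G : Graph) (ρ : RotationSystem G) where
  open Graph G
  open RotationSystem ρ
  open Surface G ρ

  -- Induction around `v`, valid because the rotation is cyclic. It often serves to refute: a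
  -- property started just after one dart is carried round to a dart where it fails.
  at-vertex : ∀ (S : Dart G → Set) v → (∀ d → tail G d ≡ v → S d → S (σ d)) →
    ∀ {d d′} → tail G d ≡ v → tail G d′ ≡ v → S d → S d′
  at-vertex S v closed {d} {d′} dv d′v Sd =
    let (k , eq) = cyclic d d′ (trans dv (sym d′v)) in subst S eq (proj₁ (orbit k))
    where
    orbit : ∀ k → S (iter G σ k d) × tail G (iter G σ k d) ≡ v
    orbit zero    = Sd , dv
    orbit (suc k) = let (s , t) = orbit k in closed _ t s , trans (local _) t

  -- The trace at `v` of the sides of a cycle through `a` and `b`. The flip comes just after each of
  -- these darts, so each has the colour of the arc that ends in it.
  record JumpsAt (f : Dart G → Bool) (v : Fin nV) (a b : Dart G) : Set where
    field
      tail-a : tail G a ≡ v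
      tail-b : tail G b ≡ v
      a≢b    : a ≢ b
      jump-a : f (σ a) ≡ not (f a)
      jump-b : f (σ b) ≡ not (f b)
      stay   : ∀ d → tail G d ≡ v → d ≢ a → d ≢ b → f (σ d) ≡ f d

    step-or-jump : ∀ d → tail G d ≡ v → (d ≡ a ⊎ d ≡ b) ⊎ (d ≢ a × d ≢ b × f (σ d) ≡ f d)
    step-or-jump d dv with _≟D_ G d a | _≟D_ G d b
    ... | yes eq | _      = inj₁ (inj₁ eq)
    ... | no _   | yes eq = inj₁ (inj₂ eq)
    ... | no d≢a | no d≢b = inj₂ (d≢a , d≢b , stay d dv d≢a d≢b)

    tail-σa : tail G (σ a) ≡ v
    tail-σa = trans (local a) tail-a

    -- Were f a = f b, the value not (f a) taken just after a could never change back before a.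
    alternates : f b ≡ not (f a)
    alternates with f b ≟B f a
    ... | no  fb≢fa = ¬-not fb≢fa
    ... | yes fb≡fa = ⊥-elim (not-¬ refl (at-vertex (λ d → f d ≡ not (f a)) v closed tail-σa tail-a jump-a))
      where
      closed : ∀ d → tail G d ≡ v → f d ≡ not (f a) → f (σ d) ≡ not (f a)
      closed d dv fd with step-or-jump d dv
      ... | inj₁ (inj₁ refl)     = ⊥-elim (not-¬ refl fd)
      ... | inj₁ (inj₂ refl)     = ⊥-elim (not-¬ fb≡fa fd)
      ... | inj₂ (_ , _ , still) = trans still fd

  -- Jumping at the same darts, `f` and `g` have a constant sum around `v`: which darts are
  -- separated depends on `a` and `b` alone, not on the rest of the cycle.
  jumps-determine : ∀ {f g v a b} → JumpsAt f v a b → JumpsAt g v a b → ∀ {c d} → tail G c ≡ v → tail G d ≡ v →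
    f c xor f d ≡ g c xor g d
  jumps-determine {f} {g} {v} {a} {b} F H {c} {d} cv dv = xor-swap (f c) (f d) (g c) (g d)
    (at-vertex (λ x → f x xor g x ≡ f d xor g d) v closed dv cv refl)
    where
    module F = JumpsAt F
    module H = JumpsAt H
    closed : ∀ x → tail G x ≡ v → f x xor g x ≡ f d xor g d → f (σ x) xor g (σ x) ≡ f d xor g d
    closed x xv eq with F.step-or-jump x xv
    ... | inj₁ (inj₁ refl)         = trans (cong₂ _xor_ F.jump-a H.jump-a) (trans (not-xor-not (f x) (g x)) eq)
    ... | inj₁ (inj₂ refl)         = trans (cong₂ _xor_ F.jump-b H.jump-b) (trans (not-xor-not (f x) (g x)) eq)
    ... | inj₂ (x≢a , x≢b , still) = trans (cong₂ _xor_ still (H.stay x xv x≢a x≢b)) eq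

  -- Starting after a, one meets either b or c first; the two terms are the indicators of "b before c" and "c before b".
  one-first : ∀ {f g v a b c} → JumpsAt f v a b → JumpsAt g v a c → b ≢ c →
    (f c xor f a) xor (g b xor g a) ≡ true
  one-first {f} {g} {v} {a} {b} {c} F H b≢c with f c ≟B f a | g b ≟B g a
  ... | yes fc≡fa | no  gb≢ga = cong₂ _xor_ (trans (cong (_xor f a) fc≡fa) (xor-same (f a))) (≢⇒xor gb≢ga)
  ... | no  fc≢fa | yes gb≡ga = cong₂ _xor_ (≢⇒xor fc≢fa) (trans (cong (_xor g a) gb≡ga) (xor-same (g a)))
  -- Neither would come first: with both colours flipped, the run after `a` can meet neither `b` nor
  -- `c` and gets back to `a`.
  ... | yes fc≡fa | yes gb≡ga = ⊥-elim (not-¬ refl (proj₁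
    (at-vertex (λ d → f d ≡ not (f a) × g d ≡ not (g a)) v closed F.tail-σa F.tail-a (F.jump-a , H.jump-a))))
    where
    module F = JumpsAt F
    module H = JumpsAt H
    closed : ∀ d → tail G d ≡ v → f d ≡ not (f a) × g d ≡ not (g a) → f (σ d) ≡ not (f a) × g (σ d) ≡ not (g a)
    closed d dv (fd , gd) with F.step-or-jump d dv | H.step-or-jump d dv
    ... | inj₁ (inj₁ refl) | _                = ⊥-elim (not-¬ refl fd)
    ... | inj₁ (inj₂ refl) | _                = ⊥-elim (not-¬ gb≡ga gd)
    ... | _                | inj₁ (inj₁ refl) = ⊥-elim (not-¬ refl fd)
    ... | _                | inj₁ (inj₂ refl) = ⊥-elim (not-¬ fc≡fa fd)
    ... | inj₂ (_ , _ , still) | inj₂ (_ , _ , still′) = trans still fd , trans still′ gd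
  -- Both would come first: after `b` the colour `f` is restored and `g` still flipped; the run
  -- cannot meet `c`, where `f` is flipped, and gets to `a`.
  ... | no fc≢fa  | no gb≢ga  = ⊥-elim (not-¬ refl (proj₂
    (at-vertex (λ d → f d ≡ f a × g d ≡ not (g a)) v closed (trans (local b) F.tail-b) F.tail-a (fσb , gσb))))
    where
    module F = JumpsAt F
    module H = JumpsAt H
    fσb : f (σ b) ≡ f a
    fσb = trans F.jump-b (trans (cong not F.alternates) (not-involutive (f a)))
    gσb : g (σ b) ≡ not (g a)
    gσb = trans (H.stay b F.tail-b (F.a≢b ∘ sym) b≢c) (¬-not gb≢ga)
    closed : ∀ d → tail G d ≡ v → f d ≡ f a × g d ≡ not (g a) → f (σ d) ≡ f a × g (σ d) ≡ not (g a)
    closed d dv (fd , gd) with F.step-or-jump d dv | H.step-or-jump d dv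
    ... | inj₁ (inj₁ refl) | _                = ⊥-elim (not-¬ refl gd)
    ... | inj₁ (inj₂ refl) | _                = ⊥-elim (not-¬ fd F.alternates)
    ... | _                | inj₁ (inj₁ refl) = ⊥-elim (not-¬ refl gd)
    ... | _                | inj₁ (inj₂ refl) = ⊥-elim (fc≢fa fd)
    ... | inj₂ (_ , _ , still) | inj₂ (_ , _ , still′) = trans still fd , trans still′ gd

  -- The outcome of `jordan` in local form: a colouring that changes exactly across the edges of
  -- `C`, with `rotates` expressing that it is constant on faces.
  record Side (f : Dart G → Bool) (C : Fin nE → Set) : Set where
    field
      crosses : ∀ d → C (proj₁ d) → f (reverse G d) ≡ not (f d)
      stays   : ∀ d → ¬ C (proj₁ d) → f (reverse G d) ≡ f d
      rotates : ∀ d → f (σ d) ≡ f (reverse G d)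

    crosses-edge : ∀ {e u w} → Joins G e u w → C e → f (dartAt G e w) ≡ not (f (dartAt G e u))
    crosses-edge {e} {u} j Ce = trans (cong f (sym (reverse-dartAt G j))) (crosses (dartAt G e u) Ce)

    stays-edge : ∀ {e u w} → Joins G e u w → ¬ C e → f (dartAt G e w) ≡ f (dartAt G e u)
    stays-edge {e} {u} j ¬Ce = trans (cong f (sym (reverse-dartAt G j))) (stays (dartAt G e u) ¬Ce)

    dart-incident : ∀ d {v} → tail G d ≡ v → Incident G (proj₁ d) v
    dart-incident (e , true)  eq = inj₁ eq
    dart-incident (e , false) eq = inj₂ eq

    constant-off : ∀ {v} → (∀ g → Incident G g v → ¬ C g) → ∀ {d d′} → tail G d ≡ v → tail G d′ ≡ v → f d ≡ f d′
    constant-off {v} off {d} {d′} dv d′v = at-vertex (λ x → f x ≡ f d′) v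
      (λ x xv eq → trans (rotates x) (trans (stays x (off _ (dart-incident x xv))) eq)) d′v dv refl

    jumps : ∀ {v a b x y} → Joins G a v x → Joins G b v y → C a → C b → a ≢ b →
      (∀ g → C g → Incident G g v → ¬ (g ≢ a × g ≢ b)) → JumpsAt f v (dartAt G a v) (dartAt G b v)
    jumps {v} {a} {b} ja jb Ca Cb a≢b only = record
      { tail-a = tail-dartAt G ja
      ; tail-b = tail-dartAt G jb
      ; a≢b    = a≢b ∘ cong proj₁
      ; jump-a = trans (rotates _) (crosses _ Ca)
      ; jump-b = trans (rotates _) (crosses _ Cb)
      ; stay   = λ d dv d≢a d≢b → trans (rotates d) (stays d λ Cd →
          only (proj₁ d) Cd (dart-incident d dv) (d≢a ∘ same dv , d≢b ∘ same dv))
      }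
      where
      same : ∀ {d e} → tail G d ≡ v → proj₁ d ≡ e → d ≡ dartAt G e v
      same {d} refl refl = sym (dartAt-tail G d)

    -- The ends may lie on the cycle, where both colours occur; therefore darts are compared and not
    -- vertices.
    along-disjoint : ∀ {u v} (P : Walk G u v) (u≢v : u ≢ v) → IsPath G P →
      (∀ e → e ∈ walkEdges G P → ¬ C e) →
      (∀ x → x ∈ walkVerts G P → x ≢ u → x ≢ v → ∀ g → Incident G g x → ¬ C g) →
      f (dartAt G (last G P u≢v) v) ≡ f (dartAt G (first G P u≢v) u)
    along-disjoint []            u≢v _ _ _ = ⊥-elim (u≢v refl)
    along-disjoint (step e j []) _   _ offE _ = stays-edge j (offE e (here refl))
    along-disjoint {u} {v} (step {w = w} e j P@(step e′ j′ P′)) _ path offE offV = begin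
      f (dartAt G (lastAfter G e′ P′) v)  ≡⟨ along-disjoint P w≢v (path-tail G j P path) (λ g g∈ → offE g (there g∈))
                                               (λ x x∈ _ x≢v → offV x (there x∈) (λ { refl → source-fresh G j P path x∈ }) x≢v) ⟩
      f (dartAt G e′ w)                   ≡⟨ constant-off (offV w (there (here refl)) (Joins⇒≢ G j ∘ sym) w≢v)
                                               (tail-dartAt G j′) (tail-dartAt G (Joins-sym G j)) ⟩
      f (dartAt G e w)                    ≡⟨ stays-edge j (offE e (here refl)) ⟩
      f (dartAt G e u)                    ∎
      where
      open ≡-Reasoning
      w≢v : w ≢ v
      w≢v refl = source-fresh G j′ P′ (path-tail G j P path) (target∈ G P′)

    -- A path with `n` edges has `n` flips from a dart to its reverse and `n - 1` flips between the
    -- two cycle darts at inner vertices, an odd number in total.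
    along-contained : ∀ {u v} (P : Walk G u v) (u≢v : u ≢ v) → IsPath G P →
      (∀ e → e ∈ walkEdges G P → C e) →
      (∀ x → x ∈ walkVerts G P → x ≢ u → x ≢ v → ∀ g → Incident G g x → C g → g ∈ walkEdges G P) →
      f (dartAt G (last G P u≢v) v) ≡ not (f (dartAt G (first G P u≢v) u))
    along-contained []            u≢v _ _ _ = ⊥-elim (u≢v refl)
    along-contained (step e j []) _   _ onE _ = crosses-edge j (onE e (here refl))
    along-contained {u} {v} (step {w = w} e j P@(step e′ j′ P′)) _ path onE onV = begin
      f (dartAt G (lastAfter G e′ P′) v)  ≡⟨ along-contained P w≢v (path-tail G j P path) (λ g g∈ → onE g (there g∈)) onV′ ⟩
      not (f (dartAt G e′ w))             ≡⟨ cong not (JumpsAt.alternates turn) ⟩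
      not (not (f (dartAt G e w)))        ≡⟨ cong (not ∘ not) (crosses-edge j (onE e (here refl))) ⟩
      not (not (not (f (dartAt G e u))))  ≡⟨ not-involutive _ ⟩
      not (f (dartAt G e u))              ∎
      where
      open ≡-Reasoning
      w≢v : w ≢ v
      w≢v refl = source-fresh G j′ P′ (path-tail G j P path) (target∈ G P′)
      onV′ : ∀ x → x ∈ walkVerts G P → x ≢ w → x ≢ v → ∀ g → Incident G g x → C g → g ∈ walkEdges G P
      onV′ x x∈ x≢w x≢v g i Cg with onV x (there x∈) (λ { refl → source-fresh G j P path x∈ }) x≢v g i Cg
      ... | there g∈  = g∈
      ... | here refl with Incident-ends G j i
      ...   | inj₁ refl = ⊥-elim (source-fresh G j P path x∈)
      ...   | inj₂ refl = ⊥-elim (x≢w refl)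
      turn : JumpsAt f w (dartAt G e w) (dartAt G e′ w)
      turn = jumps (Joins-sym G j) j′ (onE e (here refl)) (onE e′ (there (here refl)))
        (λ { refl → edge-fresh G j P path (here refl) }) only
        where
        only : ∀ g → C g → Incident G g w → ¬ (g ≢ e × g ≢ e′)
        only g Cg i (g≢e , g≢e′) with onV w (there (here refl)) (Joins⇒≢ G j ∘ sym) w≢v g i Cg
        ... | here eq          = g≢e eq
        ... | there (here eq)  = g≢e′ eq
        ... | there (there g∈) = source-fresh G j′ P′ (path-tail G j P path) (Incident⇒∈ G P′ g∈ i)

  InternallyDisjoint : ∀ {u v} → Walk G u v → Walk G u v → Set
  InternallyDisjoint {u} {v} P Q =
    (∀ e → e ∈ walkEdges G P → e ∈ walkEdges G Q → ⊥) ×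
    (∀ x → x ∈ walkVerts G P → x ∈ walkVerts G Q → x ≡ u ⊎ x ≡ v)

  module Cycles (connected : Connected G) (euler : nV + faceCount G ρ ≡ nE + 2) where

    _∪_ : ∀ {u v} → Walk G u v → Walk G u v → Fin nE → Set
    (P ∪ Q) e = e ∈ walkEdges G P ⊎ e ∈ walkEdges G Q

    cycle-side : ∀ {u v} (P Q : Walk G u v) → u ≢ v → IsPath G P → IsPath G Q → InternallyDisjoint P Q →
      ∃ λ f → Side f (P ∪ Q)
    cycle-side {u} P Q u≢v pathP pathQ (disjoint , _) =
      -- The base dart is arbitrary; `u≢v` supplies one.
      let (f , inv , diff) = jordan connected u (dartAt G (first G P u≢v) u) euler P Q
      in f , side f inv diff
      where
      xor-true : ∀ b → b xor true ≡ not b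
      xor-true b = xor-comm b true
      Z : Fin nE → Bool
      Z e = parity G P e xor parity G Q e
      on : ∀ {e} → (P ∪ Q) e → Z e ≡ true
      on (inj₁ e∈) = cong₂ _xor_ (parity-∈ G P (path⇒uniqueEdges G P pathP) e∈) (parity-∉ G Q (disjoint _ e∈))
      on (inj₂ e∈) = cong₂ _xor_ (parity-∉ G P λ e∈P → disjoint _ e∈P e∈) (parity-∈ G Q (path⇒uniqueEdges G Q pathQ) e∈)
      off : ∀ {e} → ¬ (P ∪ Q) e → Z e ≡ false
      off ¬C = cong₂ _xor_ (parity-∉ G P (¬C ∘ inj₁)) (parity-∉ G Q (¬C ∘ inj₂))
      side : ∀ f → Invariant f → (∀ e → edgeDiff f e ≡ Z e) → Side f (P ∪ Q)
      side f inv diff = record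
        { crosses = λ d Cd → trans (flip d) (trans (cong (f d xor_) (on Cd)) (xor-true (f d)))
        ; stays   = λ d ¬Cd → trans (flip d) (trans (cong (f d xor_) (off ¬Cd)) (xor-identityʳ (f d)))
        ; rotates = λ d → sym (reverse≡σ inv d)
        }
        where
        flip : ∀ d → f (reverse G d) ≡ f d xor Z (proj₁ d)
        flip (e , true)  = trans (sym (xor-cancel (f (e , true)) _)) (cong (f (e , true) xor_) (diff e))
        flip (e , false) = trans (sym (xor-cancel (f (e , false)) _))
          (cong (f (e , false) xor_) (trans (xor-comm (f (e , false)) _) (diff e)))

    module _ {u v} (P Q : Walk G u v) (u≢v : u ≢ v) (pathP : IsPath G P) (pathQ : IsPath G Q)
             (disjoint : InternallyDisjoint P Q) where

      firstDart lastDart : Walk G u v → Dart G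
      firstDart W = dartAt G (first G W u≢v) u
      lastDart W = dartAt G (last G W u≢v) v

      jumps-source : ∀ {f} → Side f (P ∪ Q) → JumpsAt f u (firstDart P) (firstDart Q)
      jumps-source side = Side.jumps side (proj₂ (first-joins G P u≢v)) (proj₂ (first-joins G Q u≢v))
        (inj₁ (first∈ G P u≢v)) (inj₂ (first∈ G Q u≢v))
        (λ eq → proj₁ disjoint _ (first∈ G P u≢v) (subst (_∈ walkEdges G Q) (sym eq) (first∈ G Q u≢v)))
        λ { g (inj₁ g∈) i (g≢ , _) → g≢ (first-unique G P u≢v pathP g∈ i)
          ; g (inj₂ g∈) i (_ , g≢) → g≢ (first-unique G Q u≢v pathQ g∈ i) }

      jumps-target : ∀ {f} → Side f (P ∪ Q) → JumpsAt f v (lastDart P) (lastDart Q)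
      jumps-target side = Side.jumps side (proj₂ (last-joins G P u≢v)) (proj₂ (last-joins G Q u≢v))
        (inj₁ (last∈ G P u≢v)) (inj₂ (last∈ G Q u≢v))
        (λ eq → proj₁ disjoint _ (last∈ G P u≢v) (subst (_∈ walkEdges G Q) (sym eq) (last∈ G Q u≢v)))
        λ { g (inj₁ g∈) i (g≢ , _) → g≢ (last-unique G P u≢v pathP g∈ i)
          ; g (inj₂ g∈) i (_ , g≢) → g≢ (last-unique G Q u≢v pathQ g∈ i) }

      -- The two ends of a theta graph see its three paths in opposite cyclic orders.
      theta : (W : Walk G u v) → IsPath G W → InternallyDisjoint P W → InternallyDisjoint Q W →
        ∃ λ f → JumpsAt f u (firstDart P) (firstDart Q) × JumpsAt f v (lastDart P) (lastDart Q) ×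
          f (lastDart W) xor f (lastDart Q) ≡ not (f (firstDart W) xor f (firstDart Q))
      theta W pathW (disjointPW , meetPW) (disjointQW , meetQW) =
        let (f , side) = cycle-side P Q u≢v pathP pathQ disjoint
        in f , jumps-source side , jumps-target side , trans
          (cong₂ _xor_ (along-W side) (along-Q side))
          (sym (not-distribʳ-xor (f (firstDart W)) (f (firstDart Q))))
        where
        along-W : ∀ {f} → Side f (P ∪ Q) → f (lastDart W) ≡ f (firstDart W)
        along-W side = Side.along-disjoint side W u≢v pathW
          (λ { e e∈ (inj₁ e∈P) → disjointPW e e∈P e∈ ; e e∈ (inj₂ e∈Q) → disjointQW e e∈Q e∈ })
          λ { x x∈ x≢u x≢v g i (inj₁ g∈) → Sum.[ x≢u , x≢v ] (meetPW x (Incident⇒∈ G P g∈ i) x∈)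
            ; x x∈ x≢u x≢v g i (inj₂ g∈) → Sum.[ x≢u , x≢v ] (meetQW x (Incident⇒∈ G Q g∈ i) x∈) }
        along-Q : ∀ {f} → Side f (P ∪ Q) → f (lastDart Q) ≡ not (f (firstDart Q))
        along-Q side = Side.along-contained side Q u≢v pathQ (λ e → inj₂)
          λ { x x∈ x≢u x≢v g i (inj₁ g∈) → ⊥-elim (Sum.[ x≢u , x≢v ] (proj₂ disjoint x (Incident⇒∈ G P g∈ i) x∈))
            ; x x∈ x≢u x≢v g i (inj₂ g∈) → g∈ }

      OnCycle : Fin nV → Set
      OnCycle x = x ∈ walkVerts G P ⊎ x ∈ walkVerts G Q

      -- The colour is carried along `V` to `w`, is constant at `w`, which is off the cycle, and is
      -- carried back along `W`.
      same-side : ∀ {w} (u≢w : u ≢ w) (V W : Walk G u w) → IsPath G V → IsPath G W →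
        (∀ x → x ∈ walkVerts G V → OnCycle x → x ≡ u) →
        (∀ x → x ∈ walkVerts G W → OnCycle x → x ≡ u) →
        ∃ λ f → JumpsAt f u (firstDart P) (firstDart Q) ×
          f (dartAt G (first G V u≢w) u) ≡ f (dartAt G (first G W u≢w) u)
      same-side {w} u≢w V W pathV pathW meetV meetW =
        let (f , side) = cycle-side P Q u≢v pathP pathQ disjoint
        in f , jumps-source side , trans (sym (along side V pathV meetV)) (trans
          (Side.constant-off side (λ g i Cg → u≢w (sym (meetV w (target∈ G V) (on-cycle Cg i))))
            (tail-dartAt G (proj₂ (last-joins G V u≢w))) (tail-dartAt G (proj₂ (last-joins G W u≢w))))
          (along side W pathW meetW))
        where
        on-cycle : ∀ {g x} → (P ∪ Q) g → Incident G g x → OnCycle x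
        on-cycle (inj₁ g∈) i = inj₁ (Incident⇒∈ G P g∈ i)
        on-cycle (inj₂ g∈) i = inj₂ (Incident⇒∈ G Q g∈ i)
        along : ∀ {f} → Side f (P ∪ Q) → (X : Walk G u w) → IsPath G X → (∀ x → x ∈ walkVerts G X → OnCycle x → x ≡ u) →
          f (dartAt G (last G X u≢w) w) ≡ f (dartAt G (first G X u≢w) u)
        along side X pathX meetX = Side.along-disjoint side X u≢w pathX
          -- A common edge of `X` and the cycle would have both ends equal to `u`.
          (λ e e∈ Ce → loopless e (trans (end e∈ Ce (inj₁ refl)) (sym (end e∈ Ce (inj₂ refl)))))
          (λ x x∈ x≢u _ g i Cg → x≢u (meetX x x∈ (on-cycle Cg i)))
          where
          end : ∀ {e x} → e ∈ walkEdges G X → (P ∪ Q) e → Incident G e x → x ≡ u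
          end e∈ Ce i = meetX _ (Incident⇒∈ G X e∈ i) (on-cycle Ce i)

-- Terminals and trees

enumerate : ∀ {n} (p : Subset n) {m} → m ≤ ∣ p ∣ →
  ∃ λ (t : Fin m → Fin n) → Injective _≡_ _≡_ t × (∀ i → t i ∈S p)
enumerate p {zero} _ = (λ ()) , (λ { {()} }) , λ ()
enumerate (outside ∷ p) {suc m} m≤ =
  let (t , inj , t∈) = enumerate p m≤
  in suc ∘ t , inj ∘ suc-injective , Vec.there ∘ t∈
enumerate (inside ∷ p) {suc m} (s≤s m≤) =
  let (t , inj , t∈) = enumerate p m≤
  in (λ { zero → zero ; (suc i) → suc (t i) })
   , (λ { {zero} {zero} _ → refl ; {suc i} {suc j} eq → cong suc (inj (suc-injective eq)) })
   , λ { zero → Vec.here ; (suc i) → Vec.there (t∈ i) }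

module _ {A : Set} where

  AtMostOne : (A → Set) → Set
  AtMostOne P = ∀ {x y} → P x → P y → x ≡ y

  AtLeast : ℕ → (A → Set) → Set
  AtLeast n P = ∃ λ xs → Unique xs × All P xs × n ≤ length xs

  relax : ∀ {n} {P Q : A → Set} → (∀ {x} → P x → Q x) → AtLeast n P → AtLeast n Q
  relax f (xs , u , ps , n≤) = xs , u , All.map f ps , n≤

  discard : ∀ {P Q : A → Set} → Decidable Q → AtMostOne Q → ∀ {n} → AtLeast (suc n) P → AtLeast n (λ x → P x × ¬ Q x)
  discard Q? one {zero} _ = [] , [] , [] , z≤n
  discard {P} Q? one {suc n} (x ∷ xs , x∉ ∷ u , px ∷ ps , s≤s n<) with Q? x
  ... | yes qx = xs , u , All.zipWith (λ (x≢y , py) → py , x≢y ∘ one qx) (x∉ , ps) , n<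
  ... | no ¬qx =
    -- `x ≢ y` travels inside the predicate, so that `x` is still fresh for the shortened list.
    let (ys , u′ , ps′ , n≤) = discard {P = λ y → P y × x ≢ y} Q? one (xs , u , All.zip (ps , x∉) , n<)
    in x ∷ ys , All.map (proj₂ ∘ proj₁) ps′ ∷ u′ , (px , ¬qx) ∷ All.map (λ ((py , _) , ¬qy) → py , ¬qy) ps′ , s≤s n≤

module CIST (G : Graph) (R : Subset (Graph.nV G)) (k : ℕ) (T : Fin k → STree G) (cist : IsCIST G R k T)
            {m : ℕ} (t : Fin m → Fin (Graph.nV G)) (t-injective : Injective _≡_ _≡_ t) (t∈R : ∀ x → t x ∈S R) where
  open Graph G
  open DecMembership (_≟F_ {nV}) using () renaming (_∈?_ to _∈V?_)

  ET : Fin k → Subset nE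
  ET i = proj₂ (T i)

  module Tree i = IsTree (proj₁ (proj₁ cist i))

  pathIn : ∀ i x y → Σ (Walk G (t x) (t y)) λ P → IsPath G P × UsesOnly G (ET i) P
  pathIn i x y = Conn⇒path G (Tree.connected i (t x) (t y) (R⊆ (t∈R x)) (R⊆ (t∈R y)))
    where R⊆ = proj₁ (proj₂ (proj₁ cist i))

  path : ∀ i x y → Walk G (t x) (t y)
  path i x y = proj₁ (pathIn i x y)

  isPath : ∀ i x y → IsPath G (path i x y)
  isPath i x y = proj₁ (proj₂ (pathIn i x y))

  usesOnly : ∀ i x y → UsesOnly G (ET i) (path i x y)
  usesOnly i x y = proj₂ (proj₂ (pathIn i x y))

  conn : ∀ i x y → Conn G (_∈S ET i) (t x) (t y)
  conn i x y = path i x y , usesOnly i x y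

  On : Fin k → Fin m → Fin m → Fin nV → Set
  On i x y v = v ∈ walkVerts G (path i x y)

  t-≢ : ∀ {x y} → x ≢ y → t x ≢ t y
  t-≢ x≢y = x≢y ∘ t-injective

  On-degenerate : ∀ {i x v} → On i x x v → v ≡ t x
  On-degenerate {i} {x} = trivial-path G (path i x x) (isPath i x x)

  On⇒∈ : ∀ {i x y v} → On i x y v → (c : Conn G (_∈S ET i) (t x) (t y)) → v ∈ walkVerts G (proj₁ c)
  On⇒∈ {i} {x} {y} on (W , only) with x ≟F y
  ... | yes refl = subst (_∈ walkVerts G W) (sym (On-degenerate {i} on)) (source∈ G W)
  ... | no  x≢y  = covers-vertex G (ET i) (Tree.acyclic i) (path i x y) W (t-≢ x≢y) (isPath i x y) (usesOnly i x y) only on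

  On-sym : ∀ {i x y v} → On i x y v → On i y x v
  On-sym {i} {x} {y} on = Conn-sym-∈ G (conn i y x) (On⇒∈ on (Conn-sym G (conn i y x)))

  -- The detour through `z` is a walk in the tree and so contains the path.
  On-via : ∀ {i x y v} z → On i x y v → On i x z v ⊎ On i z y v
  On-via {i} {x} {y} z on = Conn-trans-∈ G (conn i x z) (conn i z y) (On⇒∈ on (Conn-trans G (conn i x z) (conn i z y)))

  disjoint : ∀ {i j x y} → i ≢ j → x ≢ y →
    (∀ e → e ∈ walkEdges G (path i x y) → e ∈ walkEdges G (path j x y) → ⊥) ×
    (∀ v → On i x y v → On j x y v → v ≡ t x ⊎ v ≡ t y)
  disjoint {i} {j} {x} {y} i≢j x≢y = proj₂ cist i j i≢j (t x) (t y) (t∈R x) (t∈R y) (t-≢ x≢y)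
    (path i x y) (isPath i x y) (usesOnly i x y) (path j x y) (isPath j x y) (usesOnly j x y)

  meet : ∀ {i j x y v} → i ≢ j → On i x y v → On j x y v → v ≡ t x ⊎ v ≡ t y
  meet {x = x} {y} i≢j on on′ with x ≟F y
  ... | yes refl = inj₁ (On-degenerate on)
  ... | no  x≢y  = proj₂ (disjoint i≢j x≢y) _ on on′

  -- Rerouting each path through the far end of the other always produces paths of both trees with a
  -- common pair of ends, where the hypothesis applies.
  fan-meet : ∀ {i j x y z v} → i ≢ j → v ≢ t x → v ≢ t y → v ≢ t z → On i x y v → On j x z v → ⊥
  fan-meet {x = x} {y} {z} i≢j v≢x v≢y v≢z on on′ with On-via z on
  ... | inj₁ on-xz = Sum.[ v≢x , v≢z ] (meet i≢j on-xz on′)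
  ... | inj₂ on-zy with On-via y on′
  ...   | inj₁ on-xy = Sum.[ v≢x , v≢y ] (meet i≢j on on-xy)
  ...   | inj₂ on-yz = Sum.[ v≢z , v≢y ] (meet i≢j on-zy (On-sym on-yz))

  -- `t x` is internal in the part of the tree spanned by the chosen terminals. Betweenness replaces
  -- degree, so branches leading elsewhere do not count.
  Split : Fin m → Fin k → Set
  Split x i = ∃ λ y → ∃ λ z → x ≢ y × x ≢ z × On i y z (t x)

  Split? : ∀ x → Decidable (Split x)
  Split? x i = any? λ y → any? λ z → ¬? (x ≟F y) ×-dec ¬? (x ≟F z) ×-dec (t x ∈V? walkVerts G (path i y z))

  -- Rerouted through `y′`, the first path shares the end `y′` with the second, and both pass
  -- through `t x`, against `fan-meet`.
  Split-unique : ∀ x → AtMostOne (Split x)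
  Split-unique x {i} {j} (y , z , x≢y , x≢z , on) (y′ , z′ , x≢y′ , x≢z′ , on′) with i ≟F j
  ... | yes i≡j = i≡j
  ... | no  i≢j with On-via y′ on
  ...   | inj₁ on-yy′ = ⊥-elim (fan-meet i≢j (t-≢ x≢y′) (t-≢ x≢y) (t-≢ x≢z′) (On-sym on-yy′) on′)
  ...   | inj₂ on-y′z = ⊥-elim (fan-meet i≢j (t-≢ x≢y′) (t-≢ x≢z) (t-≢ x≢z′) on-y′z on′)

  firstEdge : Fin k → (x y : Fin m) → .(x ≢ y) → Fin nE
  firstEdge i x y x≢y = first G (path i x y) (t-≢ x≢y)

  firstDart : Fin k → (x y : Fin m) → .(x ≢ y) → Dart G
  firstDart i x y x≢y = dartAt G (firstEdge i x y x≢y) (t x)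

  -- The paths in the two directions are chosen independently, but the edges of one lie on the
  -- other, which has a single edge at its source.
  last≡first : ∀ i {x y} (x≢y : x ≢ y) → last G (path i x y) (t-≢ x≢y) ≡ firstEdge i y x (x≢y ∘ sym)
  last≡first i {x} {y} x≢y = first-unique G (path i y x) (t-≢ (x≢y ∘ sym)) (isPath i y x) last∈reverse
    (Joins⇒Incident G (proj₂ (last-joins G (path i x y) (t-≢ x≢y))))
    where
    last∈reverse : last G (path i x y) (t-≢ x≢y) ∈ walkEdges G (path i y x)
    last∈reverse = Conn-sym-edges G (conn i y x) (covers-edge G (ET i) (Tree.acyclic i) (path i x y) _
      (isPath i x y) (usesOnly i x y) (proj₂ (Conn-sym G (conn i y x))) (last∈ G (path i x y) (t-≢ x≢y)))

  -- Different first edges would put `t x` between `y` and `z`. A tree not split at `x` thus has one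
  -- dart at `t x` towards all terminals, and such trees have a well-defined cyclic order there.
  unsplit⇒sameDart : ∀ {i x y z} → ¬ Split x i → (x≢y : x ≢ y) (x≢z : x ≢ z) → firstDart i x y x≢y ≡ firstDart i x z x≢z
  unsplit⇒sameDart {i} {x} {y} {z} unsplit x≢y x≢z = Sum.[ cong (λ e → dartAt G e (t x)) , through ]′
    (branch-or-through G (ET i) (Tree.acyclic i) (path i x y) (path i x z) (path i y z) (t-≢ x≢y) (t-≢ x≢z)
      (isPath i x y) (isPath i x z) (usesOnly i x y) (usesOnly i x z) (usesOnly i y z))
    where
    through : On i y z (t x) → firstDart i x y x≢y ≡ firstDart i x z x≢z
    through on = ⊥-elim (unsplit (y , z , x≢y , x≢z , on))

  module Planarity (ρ : RotationSystem G) (connected : Connected G) (euler : nV + faceCount G ρ ≡ nE + 2) where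
    open Potentials G ρ
    open Cycles connected euler hiding (firstDart; lastDart)

    -- If `f` jumps at the darts of `i` and `j`, this sign is false exactly when `l` is met between
    -- `i` and `j`, turning from `i`.
    order : (Dart G → Bool) → Fin k → Fin k → (x y : Fin m) → .(x ≢ y) → Bool
    order f j l x y x≢y = f (firstDart l x y x≢y) xor f (firstDart j x y x≢y)

    -- The trees have a cyclic order at each of a, b, c, and theta would reverse it along each
    -- side of the triangle a b c.
    no-K₃₃ : ∀ {a b c i j l} → a ≢ b → a ≢ c → b ≢ c → i ≢ j → i ≢ l → j ≢ l →
      (∀ x → x ≡ a ⊎ x ≡ b ⊎ x ≡ c → ¬ Split x i × ¬ Split x j × ¬ Split x l) → ⊥
    no-K₃₃ {a} {b} {c} {i} {j} {l} a≢b a≢c b≢c i≢j i≢l j≢l unsplit =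
      let (f , fa , fb , f-rev) = theta′ a≢b
          (g , ga , gc , g-rev) = theta′ a≢c
          (h , hb , hc , h-rev) = theta′ b≢c
      in odd-triangle f-rev g-rev h-rev
           (agree (unsplit a (inj₁ refl)) a≢b a≢c fa ga)
           (agree (unsplit b (inj₂ (inj₁ refl))) (a≢b ∘ sym) b≢c fb hb)
           (agree (unsplit c (inj₂ (inj₂ refl))) (a≢c ∘ sym) (b≢c ∘ sym) gc hc)
      where
      -- Six signs around the triangle, equal at each corner and opposite along each of its three
      -- sides; three is odd.
      odd-triangle : ∀ {p p′ q q′ r r′} → p′ ≡ not p → q′ ≡ not q → r′ ≡ not r → p ≡ q → p′ ≡ r → q′ ≡ r′ → ⊥
      odd-triangle {p} refl refl refl refl refl eq = not-¬ refl eq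
      theta′ : ∀ {x y} (x≢y : x ≢ y) → ∃ λ f →
        JumpsAt f (t x) (firstDart i x y x≢y) (firstDart j x y x≢y) ×
        JumpsAt f (t y) (firstDart i y x (x≢y ∘ sym)) (firstDart j y x (x≢y ∘ sym)) ×
        order f j l y x (x≢y ∘ sym) ≡ not (order f j l x y x≢y)
      theta′ {x} {y} x≢y = replace (lastDart≡ i) (lastDart≡ j) (lastDart≡ l)
        (theta (path i x y) (path j x y) (t-≢ x≢y) (isPath i x y) (isPath j x y) (disjoint i≢j x≢y)
          (path l x y) (isPath l x y) (disjoint i≢l x≢y) (disjoint j≢l x≢y))
        where
        lastDart≡ : ∀ i → dartAt G (last G (path i x y) (t-≢ x≢y)) (t y) ≡ firstDart i y x (x≢y ∘ sym)
        lastDart≡ i = cong (λ e → dartAt G e (t y)) (last≡first i x≢y)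
        replace : ∀ {p q p₁ q₁ r₁ p₂ q₂ r₂ q₃ r₃} {u v : Fin nV} → p₁ ≡ p₂ → q₁ ≡ q₂ → r₁ ≡ r₂ →
          (∃ λ f → JumpsAt f u p q × JumpsAt f v p₁ q₁ × f r₁ xor f q₁ ≡ not (f r₃ xor f q₃)) →
          ∃ λ f → JumpsAt f u p q × JumpsAt f v p₂ q₂ × f r₂ xor f q₂ ≡ not (f r₃ xor f q₃)
        replace refl refl refl result = result
      -- `f` and `g` come from different cycles but jump at the same two darts of `t x`.
      agree : ∀ {x y z f g} → ¬ Split x i × ¬ Split x j × ¬ Split x l → (x≢y : x ≢ y) (x≢z : x ≢ z) →
        JumpsAt f (t x) (firstDart i x y x≢y) (firstDart j x y x≢y) →
        JumpsAt g (t x) (firstDart i x z x≢z) (firstDart j x z x≢z) →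
        order f j l x y x≢y ≡ order g j l x z x≢z
      agree {x} {y} {z} (¬i , ¬j , ¬l) x≢y x≢z F H = determine
        (unsplit⇒sameDart ¬i x≢y x≢z) (unsplit⇒sameDart ¬j x≢y x≢z) (unsplit⇒sameDart ¬l x≢y x≢z)
        F H (tail-dartAt G (proj₂ (first-joins G (path l x y) (t-≢ x≢y))))
        where
        determine : ∀ {f g v p q r p′ q′ r′} → p ≡ p′ → q ≡ q′ → r ≡ r′ → JumpsAt f v p q → JumpsAt g v p′ q′ →
          tail G r ≡ v → f r xor f q ≡ g r′ xor g q′
        determine refl refl refl F H rv = jumps-determine F H rv (JumpsAt.tail-b F)

    -- The cycle of `i`, `j` through `p` and the one of `l`, `n` through `q` meet only in `t a`:
    -- `fan-meet` handles vertices other than these terminals, and `p`, `q` do not split in the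
    -- trees of the other cycle.
    pencil : ∀ {a p q i j l n} → p ≢ q → i ≢ j → i ≢ l → i ≢ n → j ≢ l → j ≢ n →
      ¬ Split p l → ¬ Split p n → ¬ Split q i → ¬ Split q j → (a≢p : a ≢ p) (a≢q : a ≢ q) →
      ∃ λ f → JumpsAt f (t a) (firstDart i a p a≢p) (firstDart j a p a≢p) ×
        f (firstDart l a q a≢q) ≡ f (firstDart n a q a≢q)
    pencil {a} {p} {q} {i} {j} {l} {n} p≢q i≢j i≢l i≢n j≢l j≢n ¬pl ¬pn ¬qi ¬qj a≢p a≢q =
      same-side (path i a p) (path j a p) (t-≢ a≢p) (isPath i a p) (isPath j a p) (disjoint i≢j a≢p)
        (t-≢ a≢q) (path l a q) (path n a q) (isPath l a q) (isPath n a q)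
        (λ v on → Sum.[ only-a i≢l ¬qi ¬pl on , only-a j≢l ¬qj ¬pl on ])
        (λ v on → Sum.[ only-a i≢n ¬qi ¬pn on , only-a j≢n ¬qj ¬pn on ])
      where
      only-a : ∀ {i l v} → i ≢ l → ¬ Split q i → ¬ Split p l → On l a q v → On i a p v → v ≡ t a
      only-a {v = v} i≢l ¬qi ¬pl on-q on-p with v ≟F t a | v ≟F t p | v ≟F t q
      ... | yes eq | _ | _ = eq
      ... | no _ | yes refl | _ = ⊥-elim (¬pl (a , q , a≢p ∘ sym , p≢q , on-q))
      ... | no _ | no _ | yes refl = ⊥-elim (¬qi (a , p , a≢q ∘ sym , p≢q ∘ sym , on-p))
      ... | no v≢a | no v≢p | no v≢q = ⊥-elim (fan-meet i≢l v≢a v≢p v≢q on-p on-q)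

    -- The three ways of pairing four trees at a are all uncrossed, which no cyclic order of four darts allows.
    no-K₅ : ∀ {a b c d i j l n} → (a≢b : a ≢ b) → a ≢ c → a ≢ d → b ≢ c → b ≢ d →
      i ≢ j → i ≢ l → i ≢ n → j ≢ l → j ≢ n → l ≢ n →
      ¬ Split a j → ¬ Split a l → ¬ Split a n → ¬ Split b j → ¬ Split b l → ¬ Split b n →
      ¬ Split c i → ¬ Split c l → ¬ Split c n → ¬ Split d i → ¬ Split d j → ⊥
    no-K₅ {a} {b} {c} {d} {i} {j} {l} {n} a≢b a≢c a≢d b≢c b≢d i≢j i≢l i≢n j≢l j≢n l≢n
      ¬aj ¬al ¬an ¬bj ¬bl ¬bn ¬ci ¬cl ¬cn ¬di ¬dj =
      -- In the application `b`, `c`, `d` split in `i`, `j`, `l`. So the pair with `i` closes up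
      -- through `b`, the other pair through a terminal unsplit in the first: `d` against `j`, but
      -- `c` against `l` and `n`.
      let (f , Jf , f-eq) = pencil b≢d i≢j i≢l i≢n j≢l j≢n ¬bl ¬bn ¬di ¬dj a≢b a≢d
          (g , Jg , g-eq) = pencil b≢c i≢l i≢j i≢n (j≢l ∘ sym) l≢n ¬bj ¬bn ¬ci ¬cl a≢b a≢c
          (h , Jh , h-eq) = pencil b≢c i≢n i≢j i≢l (j≢n ∘ sym) (l≢n ∘ sym) ¬bj ¬bl ¬ci ¬cn a≢b a≢c
      in odd-matching
           (same f ¬al a≢d ¬an f-eq) (same g ¬aj a≢c ¬an g-eq) (same h ¬aj a≢c ¬al h-eq)
           (one-first Jf Jg (distinct j≢l)) (one-first Jf Jh (distinct j≢n)) (one-first Jg Jh (distinct l≢n))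
      where
      X : Fin k → Dart G
      X i = firstDart i a b a≢b
      same : ∀ f {i j y} → ¬ Split a i → (a≢y : a ≢ y) → ¬ Split a j →
        f (firstDart i a y a≢y) ≡ f (firstDart j a y a≢y) → f (X i) ≡ f (X j)
      same f {i} {j} ¬i a≢y ¬j eq =
        trans (cong f (unsplit⇒sameDart ¬i a≢b a≢y)) (trans eq (cong f (unsplit⇒sameDart ¬j a≢y a≢b)))
      distinct : ∀ {i j} → i ≢ j → X i ≢ X j
      distinct {i} {j} i≢j eq = proj₁ (disjoint i≢j a≢b) _ (first∈ G (path i a b) (t-≢ a≢b))
        (subst (_∈ walkEdges G (path j a b)) (sym (cong proj₁ eq)) (first∈ G (path j a b) (t-≢ a≢b)))
      -- Turning from the dart of `i`, an uncrossed pairing makes the partner of `i` first or last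
      -- among the other three; `j`, `l` and `n` cannot all be so. In bits: three values would be
      -- pairwise different.
      odd-matching : ∀ {fi fl fn gi gj gn hi hj hl} → fl ≡ fn → gj ≡ gn → hj ≡ hl →
        (fl xor fi) xor (gj xor gi) ≡ true → (fn xor fi) xor (hj xor hi) ≡ true → (gn xor gi) xor (hl xor hi) ≡ true → ⊥
      odd-matching {fi} {fl} {_} {gi} {gj} {_} {hi} {hj} refl refl refl = pairwise (fl xor fi) (gj xor gi) (hj xor hi)
        where
        pairwise : ∀ p q r → p xor q ≡ true → p xor r ≡ true → q xor r ≡ true → ⊥
        pairwise false true  true  _  _  ()
        pairwise true  false false _  _  ()
        pairwise false false _     () _  _
        pairwise false true  false _  () _
        pairwise true  true  _     () _  _
        pairwise true  false true  _  () _

    -- Counting the trees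

    no-three-unsplit : ∀ {a b c} → a ≢ b → a ≢ c → b ≢ c →
      ¬ AtLeast 3 (λ i → ¬ Split a i × ¬ Split b i × ¬ Split c i)
    no-three-unsplit a≢b a≢c b≢c
      (i ∷ j ∷ l ∷ _ , (i≢j ∷ i≢l ∷ _) ∷ (j≢l ∷ _) ∷ _ , (ai , bi , ci) ∷ (aj , bj , cj) ∷ (al , bl , cl) ∷ _ , _) =
      no-K₃₃ a≢b a≢c b≢c i≢j i≢l j≢l λ
        { x (inj₁ refl)        → ai , aj , al
        ; x (inj₂ (inj₁ refl)) → bi , bj , bl
        ; x (inj₂ (inj₂ refl)) → ci , cj , cl }
    no-three-unsplit _ _ _ (_ ∷ [] , _ , _ , s≤s ())
    no-three-unsplit _ _ _ (_ ∷ _ ∷ [] , _ , _ , s≤s (s≤s ()))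

    discard-split : ∀ x {n} {P : Fin k → Set} → AtLeast (suc n) P → AtLeast n (λ i → P i × ¬ Split x i)
    discard-split x = discard (Split? x) (Split-unique x)

    trees : ∀ {n} → n ≤ k → AtLeast n (λ (_ : Fin k) → ⊤)
    trees n≤k = allFin k , allFin⁺ k , All.tabulate (λ _ → tt) , ≤-trans n≤k (≤-reflexive (sym (length-tabulate id)))

    at-most-five : ∀ {a b c} → a ≢ b → a ≢ c → b ≢ c → ¬ 6 ≤ k
    at-most-five {a} {b} {c} a≢b a≢c b≢c 6≤k = no-three-unsplit a≢b a≢c b≢c
      (relax (λ (((_ , ¬a) , ¬b) , ¬c) → ¬a , ¬b , ¬c) (discard-split c (discard-split b (discard-split a (trees 6≤k)))))

    module _ (5≤k : 5 ≤ k) where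

      -- Otherwise only `b` and `c` could spoil trees, and 5 - 2 = 3 would remain.
      splits : ∀ {a b c} → a ≢ b → a ≢ c → b ≢ c → ∃ (Split a)
      splits {a} {b} {c} a≢b a≢c b≢c with any? (Split? a)
      ... | yes p = p
      ... | no ∄i = ⊥-elim (no-three-unsplit a≢b a≢c b≢c
        (relax (λ {i} ((_ , ¬b) , ¬c) → (λ s → ∄i (i , s)) , ¬b , ¬c) (discard-split c (discard-split b (trees 5≤k)))))

      -- If `a` and `b` split in the same tree, then removing it and the tree of `c` would again
      -- leave three.
      splits-one : ∀ {a b c} → a ≢ b → a ≢ c → b ≢ c → ∀ {i} → Split a i → ¬ Split b i
      splits-one {a} {b} {c} a≢b a≢c b≢c {i} ai bi = no-three-unsplit a≢b a≢c b≢c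
        (relax (λ ((_ , ¬a) , ¬c) → ¬a , (λ bj → ¬a (subst (Split a) (Split-unique b bi bj) ai)) , ¬c)
          (discard-split c (discard-split a (trees 5≤k))))

      -- Of five trees at least one, `n`, is split by none of the four terminals. It joins the trees
      -- split by `b`, `c` and `d`; in all four of them `a` is unsplit.
      no-four-terminals : ∀ {a b c d} → a ≢ b → a ≢ c → a ≢ d → b ≢ c → b ≢ d → c ≢ d → ⊥
      no-four-terminals {a} {b} {c} {d} a≢b a≢c a≢d b≢c b≢d c≢d =
        contradiction (splits b≢c b≢d c≢d) (splits (b≢c ∘ sym) c≢d b≢d) (splits (b≢d ∘ sym) (c≢d ∘ sym) b≢c)
          (discard-split d (discard-split c (discard-split b (discard-split a (trees 5≤k)))))
        where
        contradiction : ∃ (Split b) → ∃ (Split c) → ∃ (Split d) →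
          ¬ AtLeast 1 (λ i → (((⊤ × ¬ Split a i) × ¬ Split b i) × ¬ Split c i) × ¬ Split d i)
        contradiction (i , bi) (j , cj) (l , dl) (n ∷ _ , _ , ((((_ , ¬an) , ¬bn) , ¬cn) , ¬dn) ∷ _ , _) =
          no-K₅ a≢b a≢c a≢d b≢c b≢d
            (λ { refl → splits-one b≢c b≢d c≢d bi cj })
            (λ { refl → splits-one b≢d b≢c (c≢d ∘ sym) bi dl })
            (λ { refl → ¬bn bi })
            (λ { refl → splits-one c≢d (b≢c ∘ sym) (b≢d ∘ sym) cj dl })
            (λ { refl → ¬cn cj })
            (λ { refl → ¬dn dl })
            (splits-one (a≢c ∘ sym) (b≢c ∘ sym) a≢b cj) (splits-one (a≢d ∘ sym) (b≢d ∘ sym) a≢b dl) ¬an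
            (splits-one (b≢c ∘ sym) c≢d b≢d cj) (splits-one (b≢d ∘ sym) (c≢d ∘ sym) b≢c dl) ¬bn
            (splits-one b≢c b≢d c≢d bi) (splits-one (c≢d ∘ sym) (b≢d ∘ sym) (b≢c ∘ sym) dl) ¬cn
            (splits-one b≢d b≢c (c≢d ∘ sym) bi) (splits-one c≢d (b≢c ∘ sym) (b≢d ∘ sym) cj)

theorem3p19 : (G : Graph) → Connected G → Planar G →
    (R : Subset (Graph.nV G)) → (k : ℕ) → (T : Fin k → STree G) → IsCIST G R k T →
    ((∣ R ∣ ≡ 3 → k ≤ 5) × (4 ≤ ∣ R ∣ → k ≤ 4))
theorem3p19 G connected planar R k T cist =
  (λ ∣R∣≡3 → three (≤-reflexive (sym ∣R∣≡3)) planar) , λ 4≤∣R∣ → four 4≤∣R∣ planar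
  where
  -- The one-vertex graph is planar by decree, without a rotation system, but has too few terminals.
  one-vertex : Graph.nV G ≡ 1 → ¬ 2 ≤ ∣ R ∣
  one-vertex nV≡1 2≤∣R∣ with ≤-trans 2≤∣R∣ (≤-trans (∣p∣≤n R) (≤-reflexive nV≡1))
  ... | s≤s ()

  three : 3 ≤ ∣ R ∣ → Planar G → k ≤ 5
  three 3≤∣R∣ (inj₁ nV≡1) = ⊥-elim (one-vertex nV≡1 (≤-trans (s≤s (s≤s z≤n)) 3≤∣R∣))
  three 3≤∣R∣ (inj₂ (ρ , euler)) =
    let (t , inj , t∈R) = enumerate R 3≤∣R∣
    in ≮⇒≥ (CIST.Planarity.at-most-five G R k T cist t inj t∈R ρ connected euler {0F} {1F} {2F} (λ ()) (λ ()) λ ())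

  four : 4 ≤ ∣ R ∣ → Planar G → k ≤ 4
  four 4≤∣R∣ (inj₁ nV≡1) = ⊥-elim (one-vertex nV≡1 (≤-trans (s≤s (s≤s z≤n)) 4≤∣R∣))
  four 4≤∣R∣ (inj₂ (ρ , euler)) =
    let (t , inj , t∈R) = enumerate R 4≤∣R∣
    in ≮⇒≥ λ 5≤k → CIST.Planarity.no-four-terminals G R k T cist t inj t∈R ρ connected euler 5≤k
         {0F} {1F} {2F} {3F} (λ ()) (λ ()) (λ ()) (λ ()) (λ ()) λ ()
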